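{- There exists a constant $c>0$ such that for every positive integer $m$ there exists a directed graph $D$ with $m$ arcs such that $UG(D)$ is triangle-free and every directed cut of $D$ has size at most $m/4+c\,m^{4/5}$.
   Context: For a directed graph $D$, $UG(D)$ denotes its underlying undirected graph (obtained by forgetting arc orientations). For a partition $(U,V)$ of the vertex set of $D$, the directed cut $(U,V)$ is the set of arcs whose tail lies in $U$ and whose head lies in $V$; its size is the number of such arcs. -}

module Defs where

open import Data.Nat using (ℕ; zero; suc; _+_)
open import Data.Bool using (Bool; true; false; _∧_; not; if_then_else_)
open import Data.Fin using (Fin)
open import Data.List using (List; []; _∷_)
open import Data.Product using (_×_; _,_)
open import Data.Sum using (_⊎_)
open import Data.List.Membership.Propositional using (_∈_)
open import Data.List.Relation.Unary.Unique.Propositional using (Unique)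
open import Relation.Binary.PropositionalEquality using (_≡_)
open import Relation.Nullary using (¬_)

-- A directed graph on vertex set Fin n, given by its list of arcs (tail , head).
-- Standard (simple) digraph: no loops, no parallel arcs (2-cycles allowed).
Arcs : ℕ → Set
Arcs n = List (Fin n × Fin n)

Loopless : {n : ℕ} → Arcs n → Set
Loopless {n} A = (u v : Fin n) → (u , v) ∈ A → ¬ (u ≡ v)

IsDigraph : {n : ℕ} → Arcs n → Set
IsDigraph A = Loopless A × Unique A

AdjUG : {n : ℕ} → Arcs n → Fin n → Fin n → Set
AdjUG A u v = ((u , v) ∈ A) ⊎ ((v , u) ∈ A)

-- UG(D) is triangle-free: no three pairwise adjacent vertices
-- (adjacent vertices are automatically distinct since D is loopless)
UGTriangleFree : {n : ℕ} → Arcs n → Set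
UGTriangleFree {n} A =
  (a b c : Fin n) → ¬ (AdjUG A a b × AdjUG A b c × AdjUG A a c)

dicutSize : {n : ℕ} → (Fin n → Bool) → Arcs n → ℕ
dicutSize S [] = 0
dicutSize S ((t , h) ∷ A) =
  (if S t ∧ not (S h) then 1 else 0) + dicutSize S A

{-# OPTIONS --safe #-}
-- In 𝔽ₚ³ take the p³ lines {(x, u + xy, v + xy²)}, indexed by (y, u, v): each has p points and no
-- three of them form a triangle.  Colour the points of every line with two colours and join, in both
-- directions, any two points of a line that get different colours; the underlying graph is
-- triangle-free.  On a line with m arcs, a vertex set S satisfies 8 · dicut ≤ 2m + δ², where δ is the
-- number of points at which S agrees with the colouring minus the number at which it disagrees, so it
-- suffices to make Σ δ² = O(p⁴) for all S at once.  The colours are chosen greedily, point by point,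
-- so as not to increase the sum over all S of the product over the lines of the likelihood that a
-- Pólya urn assigns to the agreement pattern, relative to fair coin tosses: the two colours together
-- preserve that sum on average, while an imbalance δ forces a likelihood ratio of order 2^(c δ²/p).
-- A Chebyshev-type argument yields a prime in each interval (4^i, 4^(i+1)], and disjoint unions of
-- the resulting digraphs, used from the largest size that fits downwards, realise every m.
module Submission where

open import Defs
open import Data.Nat
open import Data.Nat.Properties
open import Data.Nat.Combinatorics using (_C_; nCk+nC[k+1]≡[n+1]C[k+1]; nCk≡n!/k![n-k]!; k>n⇒nCk≡0; k![n∸k]!∣n!)
open import Data.Nat.Divisibility
open import Data.Nat.DivMod using (_mod_; m≡m%n+[m/n]*n; m%n<n; m/n*n≤m; m/n*n≡m)
open import Data.Nat.Induction using (<-rec)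
open import Data.Nat.ListAction using (sum; product)
open import Data.Nat.ListAction.Properties using (∈⇒∣product)
open import Data.Nat.Primality using (Prime; prime?; euclidsLemma; ¬prime[1]; prime⇒nonZero; prime⇒nonTrivial; prime⇒irreducible)
open import Data.Nat.Primality.Factorisation using (PrimeFactorisation; factorise)
open import Data.Nat.Tactic.RingSolver using (solve-∀)
open import Data.Integer as ℤ using (ℤ) renaming (+_ to pos; _+_ to _+ᶻ_; _*_ to _*ᶻ_; _-_ to _-ᶻ_; ∣_∣ to abs)
import Data.Integer.Properties as ℤ
open import Data.Integer.Divisibility.Signed as ℤ using () renaming (_∣_ to _∣ᶻ_)
import Data.Integer.Tactic.RingSolver as ℤ
open import Data.Bool using (Bool; true; false; if_then_else_; not; _∧_; _xor_)
import Data.Bool.Properties as Bool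
open import Data.Fin using (Fin; zero; suc; toℕ; combine; remQuot; splitAt; _↑ˡ_; _↑ʳ_)
open import Data.Fin.Properties using (toℕ<n; toℕ-injective; toℕ-fromℕ<; combine-injective; combine-remQuot; splitAt-↑ˡ; splitAt-↑ʳ; ↑ˡ-injective; ↑ʳ-injective)
open import Data.List using (List; []; _∷_; _++_; map; length; concat; tabulate; allFin; filter; cartesianProduct)
open import Data.List.Properties using (length-++; length-map)
open import Data.List.Membership.Propositional using (_∈_)
open import Data.List.Membership.Propositional.Properties using (∈-map⁺; ∈-map⁻; ∈-++⁺ˡ; ∈-++⁺ʳ; ∈-++⁻; ∈-concat⁻′; ∈-tabulate⁻; ∈-filter⁻; ∈-cartesianProduct⁻)
open import Data.List.Relation.Unary.All as All using (All; []; _∷_)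
import Data.List.Relation.Unary.All.Properties as All
open import Data.List.Relation.Unary.AllPairs using ([]; _∷_)
import Data.List.Relation.Unary.AllPairs.Properties as AllPairs
open import Data.List.Relation.Unary.Any using (here; there)
open import Data.List.Relation.Unary.Unique.Propositional using (Unique)
import Data.List.Relation.Unary.Unique.Propositional.Properties as Unique
import Data.Vec.Functional as Vector
open import Data.Product using (Σ; ∃; ∃₂; _×_; _,_; proj₁; proj₂)
open import Data.Product.Properties using (,-injective)
open import Data.Sum as Sum using (_⊎_; inj₁; inj₂)
open import Data.Empty using (⊥; ⊥-elim)
open import Function using (_∘_)
open import Relation.Nullary
open import Relation.Nullary.Decidable using (toWitness; _×-dec_)
open import Relation.Binary.PropositionalEquality

-- Primes between consecutive powers of four

^-distribʳ-* : ∀ m n k → (m * n) ^ k ≡ m ^ k * n ^ k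
^-distribʳ-* m n zero = refl
^-distribʳ-* m n (suc k) = trans (cong (m * n *_) (^-distribʳ-* m n k)) (interchange m n (m ^ k) (n ^ k))
  where
  interchange : ∀ a b c d → a * b * (c * d) ≡ a * c * (b * d)
  interchange = solve-∀

nC0≡1 : ∀ n → n C 0 ≡ 1
nC0≡1 zero = refl
nC0≡1 (suc n) = refl

absorption : ∀ n k → suc k * (suc n C suc k) ≡ suc n * (n C k)
absorption zero zero = refl
absorption zero (suc k) = begin
  (2 + k) * (1 C (2 + k)) ≡⟨ cong ((2 + k) *_) (k>n⇒nCk≡0 {1} {2 + k} (s≤s (s≤s z≤n))) ⟩
  (2 + k) * 0             ≡⟨ *-zeroʳ (2 + k) ⟩
  0                       ≡⟨ k>n⇒nCk≡0 {0} {suc k} (s≤s z≤n) ⟨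
  0 C (suc k)             ≡⟨ *-identityˡ _ ⟨
  1 * (0 C (suc k))       ∎
  where open ≡-Reasoning
absorption (suc n) zero = begin
  1 * (suc (suc n) C 1)             ≡⟨ cong (1 *_) (nCk+nC[k+1]≡[n+1]C[k+1] (suc n) 0) ⟨
  1 * (suc n C 0 + suc n C 1)       ≡⟨ cong₂ (λ a b → 1 * (a + b)) (nC0≡1 (suc n)) (sym (*-identityˡ _)) ⟩
  1 * (1 + 1 * (suc n C 1))         ≡⟨ cong (λ a → 1 * (1 + a)) (absorption n 0) ⟩
  1 * (1 + suc n * (n C 0))         ≡⟨ cong (λ a → 1 * (1 + suc n * a)) (nC0≡1 n) ⟩
  1 * (1 + suc n * 1)               ≡⟨ *-identityˡ _ ⟩
  suc (suc n) * 1                   ≡⟨ cong (suc (suc n) *_) (nC0≡1 (suc n)) ⟨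
  suc (suc n) * (suc n C 0)         ∎
  where open ≡-Reasoning
absorption (suc n) (suc k) = begin
  (2 + k) * ((2 + n) C (2 + k))       ≡⟨ cong ((2 + k) *_) (nCk+nC[k+1]≡[n+1]C[k+1] (suc n) (suc k)) ⟨
  (2 + k) * (a + b)                   ≡⟨ ring₁ k a b ⟩
  suc k * a + a + (2 + k) * b         ≡⟨ cong₂ (λ s t → s + a + t) (absorption n k) (absorption n (suc k)) ⟩
  suc n * (n C k) + a + suc n * (n C suc k) ≡⟨ ring₂ n (n C k) a (n C suc k) ⟩
  suc n * (n C k + n C suc k) + a     ≡⟨ cong (λ s → suc n * s + a) (nCk+nC[k+1]≡[n+1]C[k+1] n k) ⟩
  suc n * a + a                       ≡⟨ +-comm _ a ⟩
  (2 + n) * a                         ∎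
  where
  open ≡-Reasoning
  a b : ℕ
  a = suc n C suc k
  b = suc n C (2 + k)
  ring₁ : ∀ k a b → (2 + k) * (a + b) ≡ suc k * a + a + (2 + k) * b
  ring₁ = solve-∀
  ring₂ : ∀ n c a d → suc n * c + a + suc n * d ≡ suc n * (c + d) + a
  ring₂ = solve-∀

-- This is `(n + 1 - k) C(n + 1, k) = (n + 1) C(n, k)` with the subtraction moved to the other side.
absorption′ : ∀ n k → suc n * (n C k) + k * (suc n C k) ≡ suc n * (suc n C k)
absorption′ n zero rewrite nC0≡1 n | nC0≡1 (suc n) = +-identityʳ _
absorption′ n (suc k) = begin
  suc n * (n C suc k) + suc k * (suc n C suc k) ≡⟨ cong (suc n * (n C suc k) +_) (absorption n k) ⟩
  suc n * (n C suc k) + suc n * (n C k)         ≡⟨ *-distribˡ-+ (suc n) (n C suc k) (n C k) ⟨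
  suc n * (n C suc k + n C k)                   ≡⟨ cong (suc n *_) (trans (+-comm (n C suc k) _) (nCk+nC[k+1]≡[n+1]C[k+1] n k)) ⟩
  suc n * (suc n C suc k)                       ∎
  where open ≡-Reasoning

-- In the harmonic triangle each entry is the sum of the two below it: 1/((n+1)C(n,k)) =
-- 1/((n+2)C(n+1,k)) + 1/((n+2)C(n+1,k+1)). Multiplied by `L`, this makes the missing quotient the
-- difference of the two given ones.
leibniz-step : ∀ L .{{_ : NonZero L}} n k → suc n * (n C k) ∣ L → (2 + n) * (suc n C k) ∣ L →
  (2 + n) * (suc n C suc k) ∣ L
leibniz-step L n k (divides u L≡u) (divides x L≡x) = divides (u ∸ x) (*-cancelˡ-≡ _ _ (suc k) (begin-equality
  suc k * L                     ≡⟨ wK≡ ⟨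
  w * K                         ≡⟨ ring₃ w n (n C k) ⟩
  w * (2 + n) * (suc n * (n C k)) ≡⟨ cong (w * (2 + n) *_) (absorption n k) ⟨
  w * (2 + n) * (suc k * (suc n C suc k)) ≡⟨ ring₄ w n k (suc n C suc k) ⟩
  suc k * (w * ((2 + n) * (suc n C suc k))) ∎))
  where
  open ≤-Reasoning
  w K : ℕ
  w = u ∸ x
  K = (2 + n) * (suc n * (n C k))
  ring₁ : ∀ x n k a b → x * ((2 + n) * a) + k * (x * ((2 + n) * b)) ≡ x * (2 + n) * (a + k * b)
  ring₁ = solve-∀
  ring₂ : ∀ x n b → x * (2 + n) * (suc n * b) ≡ suc n * (x * ((2 + n) * b))
  ring₂ = solve-∀
  ring₃ : ∀ w n a → w * ((2 + n) * (suc n * a)) ≡ w * (2 + n) * (suc n * a)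
  ring₃ = solve-∀
  ring₄ : ∀ w n k c → w * (2 + n) * (suc k * c) ≡ suc k * (w * ((2 + n) * c))
  ring₄ = solve-∀
  ring₅ : ∀ u n a → u * ((2 + n) * a) ≡ (2 + n) * (u * a)
  ring₅ = solve-∀
  eq₁ : x * K + k * L ≡ suc n * L
  eq₁ = begin-equality
    x * K + k * L ≡⟨ cong (λ l → x * K + k * l) L≡x ⟩
    x * K + k * (x * ((2 + n) * (suc n C k))) ≡⟨ ring₁ x n k (suc n * (n C k)) _ ⟩
    x * (2 + n) * (suc n * (n C k) + k * (suc n C k)) ≡⟨ cong (x * (2 + n) *_) (absorption′ n k) ⟩
    x * (2 + n) * (suc n * (suc n C k)) ≡⟨ ring₂ x n _ ⟩
    suc n * (x * ((2 + n) * (suc n C k))) ≡⟨ cong (suc n *_) L≡x ⟨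
    suc n * L ∎
  eq₂ : suc k * L + x * K ≡ u * K
  eq₂ = begin-equality
    L + k * L + x * K ≡⟨ +-assoc L _ _ ⟩
    L + (k * L + x * K) ≡⟨ cong (L +_) (trans (+-comm (k * L) _) eq₁) ⟩
    (2 + n) * L ≡⟨ cong ((2 + n) *_) L≡u ⟩
    (2 + n) * (u * (suc n * (n C k))) ≡⟨ ring₅ u n _ ⟨
    u * K ∎
  wK≡ : w * K ≡ suc k * L
  wK≡ = begin-equality
    (u ∸ x) * K ≡⟨ *-distribʳ-∸ K u x ⟩
    u * K ∸ x * K ≡⟨ cong (_∸ x * K) eq₂ ⟨
    suc k * L + x * K ∸ x * K ≡⟨ m+n∸n≡m (suc k * L) (x * K) ⟩
    suc k * L ∎

-- The entries of Leibniz's harmonic triangle are 1 / ((n + 1) C(n, k)).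
leibniz-∣ : ∀ L .{{_ : NonZero L}} n → (∀ j → 1 ≤ j → j ≤ suc n → j ∣ L) → ∀ k → k ≤ n → suc n * (n C k) ∣ L
leibniz-∣ L n mult zero _ = subst (_∣ L) (sym (trans (cong (suc n *_) (nC0≡1 n)) (*-identityʳ _))) (mult (suc n) (s≤s z≤n) ≤-refl)
leibniz-∣ L (suc n) mult (suc k) (s≤s k≤n) = leibniz-step L n k
  (leibniz-∣ L n (λ j 1≤j j≤ → mult j 1≤j (m≤n⇒m≤1+n j≤)) k k≤n)
  (leibniz-∣ L (suc n) mult k (m≤n⇒m≤1+n k≤n))

binomialSum : ℕ → ℕ → ℕ
binomialSum n zero = 0
binomialSum n (suc j) = binomialSum n j + n C j

binomialSum-pascal : ∀ n j → binomialSum (suc n) (suc j) ≡ binomialSum n (suc j) + binomialSum n j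
binomialSum-pascal n zero = cong (_+ 0) (trans (nC0≡1 (suc n)) (sym (nC0≡1 n)))
binomialSum-pascal n (suc j) = begin
  binomialSum (suc n) (suc j) + suc n C suc j ≡⟨ cong₂ _+_ (binomialSum-pascal n j) (sym (nCk+nC[k+1]≡[n+1]C[k+1] n j)) ⟩
  a + n C j + a + (n C j + n C suc j) ≡⟨ ring a (n C j) (n C suc j) ⟩
  a + n C j + n C suc j + (a + n C j) ∎
  where
  open ≡-Reasoning
  a : ℕ
  a = binomialSum n j
  ring : ∀ a b c → a + b + a + (b + c) ≡ a + b + c + (a + b)
  ring = solve-∀

binomialSum≡2^n : ∀ n → binomialSum n (suc n) ≡ 2 ^ n
binomialSum≡2^n zero = refl
binomialSum≡2^n (suc n) = begin
  binomialSum (suc n) (2 + n) ≡⟨ binomialSum-pascal n (suc n) ⟩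
  binomialSum n (suc n) + n C suc n + binomialSum n (suc n) ≡⟨ cong (λ c → binomialSum n (suc n) + c + binomialSum n (suc n)) (k>n⇒nCk≡0 (n<1+n n)) ⟩
  binomialSum n (suc n) + 0 + binomialSum n (suc n) ≡⟨ cong (λ s → s + 0 + s) (binomialSum≡2^n n) ⟩
  2 ^ n + 0 + 2 ^ n ≡⟨ ring (2 ^ n) ⟩
  2 * 2 ^ n ∎
  where
  open ≡-Reasoning
  ring : ∀ a → a + 0 + a ≡ 2 * a
  ring = solve-∀

nCk≤2^n : ∀ n k → n C k ≤ 2 ^ n
nCk≤2^n zero zero = s≤s z≤n
nCk≤2^n zero (suc k) = ≤-trans (≤-reflexive (k>n⇒nCk≡0 {0} {suc k} (s≤s z≤n))) z≤n
nCk≤2^n (suc n) zero = ≤-trans (≤-reflexive (nC0≡1 (suc n))) (m^n>0 2 (suc n))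
nCk≤2^n (suc n) (suc k) = begin
  suc n C suc k ≡⟨ nCk+nC[k+1]≡[n+1]C[k+1] n k ⟨
  n C k + n C suc k ≤⟨ +-mono-≤ (nCk≤2^n n k) (nCk≤2^n n (suc k)) ⟩
  2 ^ n + 2 ^ n ≡⟨ cong (2 ^ n +_) (+-identityʳ _) ⟨
  2 * 2 ^ n ∎
  where open ≤-Reasoning

-- A lower bound for the least common multiple of 1, ..., n+1: every `suc n * (n C k)` divides `L`
-- and so is at most `L`; summing over the n+1 entries of the row gives (n+1) 2^n ≤ (n+1) L.
multiple≥2^n : ∀ L .{{_ : NonZero L}} n → (∀ j → 1 ≤ j → j ≤ suc n → j ∣ L) → 2 ^ n ≤ L
multiple≥2^n L n mult = *-cancelˡ-≤ (suc n) (subst (λ s → suc n * s ≤ suc n * L) (binomialSum≡2^n n) (go (suc n) ≤-refl))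
  where
  open ≤-Reasoning
  go : ∀ j → j ≤ suc n → suc n * binomialSum n j ≤ j * L
  go zero _ = ≤-reflexive (*-zeroʳ (suc n))
  go (suc j) (s≤s j≤n) = begin
    suc n * (binomialSum n j + n C j) ≡⟨ *-distribˡ-+ (suc n) (binomialSum n j) _ ⟩
    suc n * binomialSum n j + suc n * (n C j) ≤⟨ +-mono-≤ (go j (m≤n⇒m≤1+n j≤n)) (∣⇒≤ (leibniz-∣ L n mult j j≤n)) ⟩
    j * L + L ≡⟨ +-comm _ L ⟩
    suc j * L ∎

-- Chebyshev's argument with central binomial coefficients

prime∤smaller! : ∀ {p} m → Prime p → m < p → ¬ (p ∣ m !)
prime∤smaller! zero pr _ p∣1 = ¬prime[1] (subst Prime (∣1⇒≡1 p∣1) pr)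
prime∤smaller! (suc m) pr m<p p∣ with euclidsLemma (suc m) (m !) pr p∣
... | inj₁ p∣sm = >⇒∤ m<p p∣sm
... | inj₂ p∣m! = prime∤smaller! m pr (<-trans (n<1+n m) m<p) p∣m!

n∣n! : ∀ n → 1 ≤ n → n ∣ n !
n∣n! (suc n) _ = m∣m*n (n !)

centralBinomial! : ∀ m → ((m + m) C m) * (m ! * m !) ≡ (m + m) !
centralBinomial! m = begin
  ((m + m) C m) * (m ! * m !) ≡⟨ cong (λ k → ((m + m) C m) * (m ! * k !)) (m+n∸n≡m m m) ⟨
  ((m + m) C m) * (m ! * (m + m ∸ m) !) ≡⟨ cong (_* (m ! * (m + m ∸ m) !)) (nCk≡n!/k![n-k]! (m≤m+n m m)) ⟩
  _ ≡⟨ m/n*n≡m (k![n∸k]!∣n! (m≤m+n m m)) ⟩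
  (m + m) ! ∎
  where
  open ≡-Reasoning
  instance
    _ = m !* (m + m ∸ m) !≢0

-- Such a prime divides (2m)! but not m!, so it survives in the quotient by m! m!.
prime∣centralBinomial : ∀ {p} m → Prime p → m < p → p ≤ m + m → p ∣ ((m + m) C m)
prime∣centralBinomial {p} m pr m<p p≤2m
  with euclidsLemma ((m + m) C m) (m ! * m !) pr
         (subst (p ∣_) (sym (centralBinomial! m))
           (∣-trans (n∣n! p (>-nonZero⁻¹ p {{prime⇒nonZero pr}})) (m≤n⇒m!∣n! p≤2m)))
... | inj₁ p∣C = p∣C
... | inj₂ p∣m!m! with euclidsLemma (m !) (m !) pr p∣m!m!
... | inj₁ p∣m! = ⊥-elim (prime∤smaller! m pr m<p p∣m!)
... | inj₂ p∣m! = ⊥-elim (prime∤smaller! m pr m<p p∣m!)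

-- A substitute for the product of the primes up to 2^j: the factor with index i collects the primes
-- in (2^i, 2^(i+1)], and the product is still at most 4^(2^j).
binomialProduct : ℕ → ℕ
binomialProduct zero = 1
binomialProduct (suc j) = ((2 ^ j + 2 ^ j) C (2 ^ j)) * binomialProduct j

prime∣binomialProduct : ∀ {p} j → Prime p → p ≤ 2 ^ j → p ∣ binomialProduct j
prime∣binomialProduct {p} zero pr p≤1 = ⊥-elim (<⇒≱ (nonTrivial⇒n>1 p {{prime⇒nonTrivial pr}}) p≤1)
prime∣binomialProduct {p} (suc j) pr p≤ with p ≤? 2 ^ j
... | yes p≤2^j = ∣n⇒∣m*n ((2 ^ j + 2 ^ j) C (2 ^ j)) (prime∣binomialProduct j pr p≤2^j)
... | no p≰2^j = ∣m⇒∣m*n (binomialProduct j) (prime∣centralBinomial (2 ^ j) pr (≰⇒> p≰2^j)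
  (subst (λ m → p ≤ 2 ^ j + m) (+-identityʳ _) p≤))

binomialProduct≤ : ∀ j → binomialProduct j ≤ 2 ^ (2 ^ j + 2 ^ j)
binomialProduct≤ zero = s≤s z≤n
binomialProduct≤ (suc j) = begin
  (m C (2 ^ j)) * binomialProduct j ≤⟨ *-mono-≤ (nCk≤2^n m (2 ^ j)) (binomialProduct≤ j) ⟩
  2 ^ m * 2 ^ m ≡⟨ ^-distribˡ-+-* 2 m m ⟨
  2 ^ (m + m) ≡⟨ cong (λ k → 2 ^ (k + k)) (cong (2 ^ j +_) (+-identityʳ (2 ^ j))) ⟨
  2 ^ (2 ^ suc j + 2 ^ suc j) ∎
  where
  open ≤-Reasoning
  m : ℕ
  m = 2 ^ j + 2 ^ j

binomialProduct≢0 : ∀ j → NonZero (binomialProduct j)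
binomialProduct≢0 zero = _
binomialProduct≢0 (suc j) = m*n≢0 ((m + m) C m) _ {{C≢0}} {{binomialProduct≢0 j}}
  where
  m : ℕ
  m = 2 ^ j
  C≢0 : NonZero ((m + m) C m)
  C≢0 = m*n≢0⇒m≢0 _ {{subst NonZero (sym (centralBinomial! m)) ((m + m) !≢0)}}

SquareFree : ℕ → Set
SquareFree s = ∀ d → 2 ≤ d → ¬ (d * d ∣ s)

-- Strong induction: a divisor `d * d` with `d ≥ 2` is divided out and `d` is absorbed into `r`,
-- until no such divisor is left.
squareDecomposition : ∀ j → 1 ≤ j → ∃₂ λ s r → j ≡ s * (r * r) × SquareFree s
squareDecomposition = <-rec _ step
  where
  step : ∀ j → (∀ {i} → i < j → 1 ≤ i → ∃₂ λ s r → i ≡ s * (r * r) × SquareFree s) →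
    1 ≤ j → ∃₂ λ s r → j ≡ s * (r * r) × SquareFree s
  step j rec 1≤j with anyUpTo? (λ d → (2 ≤? d) ×-dec (d * d ∣? j)) (suc j)
  ... | no none = j , 1 , sym (*-identityʳ j) , λ d 2≤d dd∣j →
    none (d , s≤s (≤-trans (m≤m*n d d {{>-nonZero (<⇒≤ 2≤d)}}) (∣⇒≤ {{>-nonZero 1≤j}} dd∣j)) , 2≤d , dd∣j)
  ... | yes (d , _ , 2≤d , divides i j≡) =
    let i≢0 = m*n≢0⇒m≢0 i {{subst NonZero j≡ (>-nonZero 1≤j)}}
        i<j = subst (i <_) (sym j≡) (m<m*n i (d * d) {{i≢0}} (≤-trans 2≤d (m≤m*n d d {{>-nonZero (<⇒≤ 2≤d)}})))
        s , r , i≡ , sf = rec i<j (>-nonZero⁻¹ i {{i≢0}})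
    in s , r * d , trans j≡ (trans (cong (_* (d * d)) i≡) (ring s r d)) , sf
    where
    ring : ∀ s r d → s * (r * r) * (d * d) ≡ s * (r * d * (r * d))
    ring = solve-∀

-- After `p` is divided out of `X`, every other prime of the list still divides the quotient `Y`: a
-- second copy of `p` in the list would put `p * p` into the product.
squareFreeProduct-∣ : ∀ ps X → All Prime ps → All (_∣ X) ps → SquareFree (product ps) → product ps ∣ X
squareFreeProduct-∣ [] X _ _ _ = 1∣ X
squareFreeProduct-∣ (p ∷ ps) X (pr ∷ prs) (divides Y X≡ ∷ divs) sf =
  subst (p * product ps ∣_) (trans (*-comm p Y) (sym X≡))
    (*-monoʳ-∣ p (squareFreeProduct-∣ ps Y prs (All.zipWith coprimePart (prs , All.tabulate λ r∈ → All.lookup divs r∈ , r∈))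
      λ d 2≤d dd∣ → sf d 2≤d (∣n⇒∣m*n p dd∣)))
  where
  coprimePart : ∀ {r} → Prime r × (r ∣ X × r ∈ ps) → r ∣ Y
  coprimePart {r} (rpr , r∣X , r∈ps) with euclidsLemma Y p rpr (subst (r ∣_) X≡ r∣X)
  ... | inj₁ r∣Y = r∣Y
  ... | inj₂ r∣p with prime⇒irreducible pr r∣p
  ... | inj₁ refl = ⊥-elim (¬prime[1] rpr)
  ... | inj₂ refl = ⊥-elim (sf p (nonTrivial⇒n>1 p {{prime⇒nonTrivial pr}}) (*-monoʳ-∣ p (∈⇒∣product r∈ps)))

squareFree-∣ : ∀ s X → 1 ≤ s → SquareFree s → (∀ p → Prime p → p ∣ s → p ∣ X) → s ∣ X
squareFree-∣ s X 1≤s sf divs = subst (_∣ X) (sym isFactorisation)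
  (squareFreeProduct-∣ factors X factorsPrime
    (All.zipWith (λ { (pr , p∣s) → divs _ pr p∣s }) (factorsPrime , All.tabulate λ p∈ → subst (_ ∣_) (sym isFactorisation) (∈⇒∣product p∈)))
    (subst SquareFree isFactorisation sf))
  where open PrimeFactorisation (factorise s {{>-nonZero 1≤s}})

n!≤n^n : ∀ n k → n ≤ k → n ! ≤ k ^ n
n!≤n^n zero k _ = ≤-refl
n!≤n^n (suc n) k sn≤k = *-mono-≤ sn≤k (n!≤n^n n k (<⇒≤ sn≤k))

-- At i = 3 both sides equal 8, which is why the primes are sought from i = 4 on.
2n<2^n : ∀ i → 4 ≤ i → 2 * suc i < 2 ^ i
2n<2^n i 4≤i = subst (λ i → 2 * suc i < 2 ^ i) (m+[n∸m]≡n 4≤i) (go (i ∸ 4))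
  where
  open ≤-Reasoning
  eq : ∀ k → 2 * (6 + k) ≡ 2 * (5 + k) + 2
  eq = solve-∀
  go : ∀ k → 2 * suc (4 + k) < 2 ^ (4 + k)
  go zero = toWitness {a? = 10 <? 16} _
  go (suc k) = begin-strict
    2 * (6 + k) ≡⟨ eq k ⟩
    2 * (5 + k) + 2 <⟨ +-mono-<-≤ (go k) (≤-trans (m≤m*n 2 (5 + k)) (<⇒≤ (go k))) ⟩
    2 ^ (4 + k) + 2 ^ (4 + k) ≡⟨ cong (2 ^ (4 + k) +_) (+-identityʳ _) ⟨
    2 ^ (5 + k) ∎

square≤⇒≤ : ∀ r n → r * r ≤ n * n → r ≤ n
square≤⇒≤ r n rr≤nn with r ≤? n
... | yes r≤n = r≤n
... | no r≰n = ⊥-elim (<⇒≱ (*-mono-< (≰⇒> r≰n) (≰⇒> r≰n)) rr≤nn)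

-- Write i = s r² with s square-free. The primes in s are at most 2^j, so s divides
-- `binomialProduct j`; and r ≤ R, so r² divides R! R!.
noPrimes⇒multiple : ∀ j R → (∀ p → Prime p → p ≤ R * R → p ≤ 2 ^ j) →
  ∀ i → 1 ≤ i → i ≤ R * R → i ∣ binomialProduct j * (R ! * R !)
noPrimes⇒multiple j R small i 1≤i i≤RR with squareDecomposition i 1≤i
... | s , r , refl , sf = *-pres-∣
  (squareFree-∣ s (binomialProduct j) (>-nonZero⁻¹ s) sf λ p pr p∣s → prime∣binomialProduct j pr
     (small p pr (≤-trans (∣⇒≤ p∣s) (≤-trans (m≤m*n s (r * r)) i≤RR))))
  (*-pres-∣ r∣R! r∣R!)
  where
  instance
    i≢0 : NonZero (s * (r * r))
    i≢0 = >-nonZero 1≤i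
    s≢0 : NonZero s
    s≢0 = m*n≢0⇒m≢0 s
    rr≢0 : NonZero (r * r)
    rr≢0 = m*n≢0⇒n≢0 s
    r≢0 : NonZero r
    r≢0 = m*n≢0⇒m≢0 r
  r∣R! : r ∣ R !
  r∣R! = ∣-trans (n∣n! r (>-nonZero⁻¹ r)) (m≤n⇒m!∣n! (square≤⇒≤ r R (≤-trans (m≤n*m (r * r) s) i≤RR)))

-- Without such a prime, L = `binomialProduct (i + i) * (R ! * R !)` with R² = 4^(i+1) is a common
-- multiple of 1, ..., R², hence at least 2^(R² - 1). But L is at most 2^E, where E is about R²/2.
primeExists : ∀ i → 4 ≤ i → ∃ λ p → Prime p × 4 ^ i < p × p ≤ 4 ^ suc i
primeExists i 4≤i with anyUpTo? (λ p → prime? p ×-dec (4 ^ i <? p)) (suc (4 ^ suc i))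
... | yes (p , p≤ , pr , <p) = p , pr , <p , s≤s⁻¹ p≤
... | no none = ⊥-elim (<⇒≱ (^-monoʳ-< 2 (s≤s (s≤s z≤n)) exponent) tooBig)
  where
  a R M E : ℕ
  a = 2 ^ i
  R = 2 ^ suc i
  M = pred (R * R)
  E = (a * a + a * a) + (suc i * R + suc i * R)
  instance
    R≢0 : NonZero R
    R≢0 = m^n≢0 2 (suc i)
    L≢0 : NonZero (binomialProduct (i + i) * (R ! * R !))
    L≢0 = m*n≢0 _ _ {{binomialProduct≢0 (i + i)}} {{R !* R !≢0}}
    RR≢0 : NonZero (R * R)
    RR≢0 = m*n≢0 R R
  4^≡ : ∀ k → 4 ^ k ≡ 2 ^ k * 2 ^ k
  4^≡ k = ^-distribʳ-* 2 2 k
  small : ∀ p → Prime p → p ≤ R * R → p ≤ 2 ^ (i + i)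
  small p pr p≤ = ≮⇒≥ λ lt → none (p , s≤s (subst (p ≤_) (sym (4^≡ (suc i))) p≤) , pr ,
    subst (_< p) (trans (^-distribˡ-+-* 2 i i) (sym (4^≡ i))) lt)
  open ≤-Reasoning
  R!≤ : R ! ≤ 2 ^ (suc i * R)
  R!≤ = begin
    R !             ≤⟨ n!≤n^n R R ≤-refl ⟩
    R ^ R           ≡⟨ ^-*-assoc 2 (suc i) R ⟩
    2 ^ (suc i * R) ∎
  tooBig : 2 ^ M ≤ 2 ^ E
  tooBig = begin
    2 ^ M ≤⟨ multiple≥2^n _ M (λ j 1≤j j≤ → noPrimes⇒multiple (i + i) R small j 1≤j (subst (j ≤_) (suc-pred (R * R)) j≤)) ⟩
    binomialProduct (i + i) * (R ! * R !) ≤⟨ *-mono-≤ (binomialProduct≤ (i + i)) (*-mono-≤ R!≤ R!≤) ⟩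
    2 ^ (2 ^ (i + i) + 2 ^ (i + i)) * (2 ^ (suc i * R) * 2 ^ (suc i * R))
      ≡⟨ cong₂ (λ x y → 2 ^ (x + x) * y) (^-distribˡ-+-* 2 i i) (sym (^-distribˡ-+-* 2 (suc i * R) (suc i * R))) ⟩
    2 ^ (a * a + a * a) * 2 ^ (suc i * R + suc i * R) ≡⟨ ^-distribˡ-+-* 2 (a * a + a * a) _ ⟨
    2 ^ E ∎
  exponent : E < M
  exponent = s≤s⁻¹ (begin
    -- One unit of the 2 gives strictness and the other makes up for `M` being R² - 1.
    2 + E ≤⟨ +-monoˡ-≤ E (*-mono-≤ {1} {a} {2} {2} (m^n>0 2 i) ≤-refl) ⟩
    a * 2 + E ≡⟨ eq₁ a i ⟩
    a * a + a * a + (a + a) * suc (2 * suc i) ≤⟨ +-monoʳ-≤ (a * a + a * a) (*-monoʳ-≤ (a + a) (2n<2^n i 4≤i)) ⟩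
    a * a + a * a + (a + a) * a ≡⟨ eq₂ a ⟩
    R * R ≡⟨ suc-pred (R * R) ⟨
    suc M ∎)
    where
    eq₁ : ∀ a i → a * 2 + ((a * a + a * a) + (suc i * (2 * a) + suc i * (2 * a))) ≡ a * a + a * a + (a + a) * suc (2 * suc i)
    eq₁ = solve-∀
    eq₂ : ∀ a → a * a + a * a + (a + a) * a ≡ 2 * a * (2 * a)
    eq₂ = solve-∀

-- A triangle-free space of points and lines over the integers modulo p

-- `N` lines with `p` positions each, among `n` points. By `position-unique` a point has the same
-- position on every line through it, so incidences of two lines only need to be compared position
-- by position.
record TriangleFreeSpace (N p n : ℕ) : Set where
  field
    point              : Fin N → Fin p → Fin n
    position-unique    : ∀ {k l x y} → point k x ≡ point l y → x ≡ y
    twoPointsDetermine : ∀ {k l x y} → x ≢ y → point k x ≡ point l x → point k y ≡ point l y → k ≡ l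
    noTriangle         : ∀ {k l m x y z} → x ≢ y → y ≢ z → z ≢ x →
      point k x ≡ point m x → point k y ≡ point l y → point l z ≡ point m z → k ≡ l × l ≡ m

module PrimeModulus (p : ℕ) (prime : Prime p) where

  instance
    p≢0 : NonZero p
    p≢0 = prime⇒nonZero prime

  ι : Fin p → ℤ
  ι a = pos (toℕ a)

  ∣-cong : ∀ {i j} → i ≡ j → pos p ∣ᶻ i → pos p ∣ᶻ j
  ∣-cong = subst (pos p ∣ᶻ_)

  residue-≡ : ∀ a b → a mod p ≡ b mod p → pos p ∣ᶻ (pos a -ᶻ pos b)
  residue-≡ a b eq = ℤ.divides (pos (a / p) -ᶻ pos (b / p)) (begin
    pos a -ᶻ pos b ≡⟨ cong₂ _-ᶻ_ (decompose a) (trans (decompose b) (cong (λ r → pos r +ᶻ pos (b / p) *ᶻ pos p) (sym residues))) ⟩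
    (pos (a % p) +ᶻ pos (a / p) *ᶻ pos p) -ᶻ (pos (a % p) +ᶻ pos (b / p) *ᶻ pos p) ≡⟨ ring (pos (a % p)) (pos (a / p)) (pos (b / p)) (pos p) ⟩
    (pos (a / p) -ᶻ pos (b / p)) *ᶻ pos p ∎)
    where
    open ≡-Reasoning
    residues : a % p ≡ b % p
    residues = trans (sym (toℕ-fromℕ< (m%n<n a p))) (trans (cong toℕ eq) (toℕ-fromℕ< (m%n<n b p)))
    decompose : ∀ a → pos a ≡ pos (a % p) +ᶻ pos (a / p) *ᶻ pos p
    decompose a = trans (cong pos (m≡m%n+[m/n]*n a p)) (trans (ℤ.pos-+ (a % p) _) (cong (λ t → pos (a % p) +ᶻ t) (ℤ.pos-* (a / p) p)))
    ring : ∀ r s t q → (r +ᶻ s *ᶻ q) -ᶻ (r +ᶻ t *ᶻ q) ≡ (s -ᶻ t) *ᶻ q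
    ring = ℤ.solve-∀

  euclid : ∀ i j → pos p ∣ᶻ (i *ᶻ j) → pos p ∣ᶻ i ⊎ pos p ∣ᶻ j
  euclid i j p∣ij with euclidsLemma (abs i) (abs j) prime (subst (p ∣_) (ℤ.abs-* i j) (ℤ.∣⇒∣ᵤ p∣ij))
  ... | inj₁ p∣i = inj₁ (ℤ.∣ᵤ⇒∣ p∣i)
  ... | inj₂ p∣j = inj₂ (ℤ.∣ᵤ⇒∣ p∣j)

  ι-injective : ∀ {a b} → pos p ∣ᶻ (ι a -ᶻ ι b) → a ≡ b
  ι-injective {a} {b} p∣a-b = toℕ-injective (ℤ.+-injective (ℤ.i-j≡0⇒i≡j (ι a) (ι b) (ℤ.∣i∣≡0⇒i≡0 (small _ (ℤ.∣⇒∣ᵤ p∣a-b) bound))))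
    where
    small : ∀ m → p ∣ m → m < p → m ≡ 0
    small zero    _   _   = refl
    small (suc m) p∣m m<p = ⊥-elim (>⇒∤ m<p p∣m)
    bound : abs (ι a -ᶻ ι b) < p
    bound = subst (λ i → abs i < p) (sym (ℤ.[+m]-[+n]≡m⊖n (toℕ a) (toℕ b)))
      (≤-<-trans (ℤ.∣m⊝n∣≤m⊔n (toℕ a) (toℕ b)) (⊔-lub (toℕ<n a) (toℕ<n b)))

  cancel : ∀ {x y} i → x ≢ y → pos p ∣ᶻ ((ι x -ᶻ ι y) *ᶻ i) → pos p ∣ᶻ i
  cancel {x} {y} i x≢y p∣ with euclid (ι x -ᶻ ι y) i p∣
  ... | inj₁ p∣x-y = ⊥-elim (x≢y (ι-injective p∣x-y))
  ... | inj₂ p∣i   = p∣i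

  -- The triple `(y , u , v)` stands for the line {(x, u + xy, v + xy²)}. The same type also holds
  -- the points.
  Line : Set
  Line = Fin p × Fin p × Fin p

  decode : Fin (p * (p * p)) → Line
  decode l = let y , w = remQuot {p} (p * p) l in y , remQuot {p} p w

  encode : Line → Fin (p * (p * p))
  encode (y , u , v) = combine y (combine u v)

  encode-decode : ∀ l → encode (decode l) ≡ l
  encode-decode l = let y , w = remQuot {p} (p * p) l in
    trans (cong (combine y) (combine-remQuot {p} p w)) (combine-remQuot {p} (p * p) l)

  linePoint : Line → Fin p → Line
  linePoint (y , u , v) x =
    x , (toℕ u + toℕ x * toℕ y) mod p , (toℕ v + toℕ x * (toℕ y * toℕ y)) mod p

  slope intercept₁ intercept₂ : Line → Fin p
  slope      = proj₁
  intercept₁ = proj₁ ∘ proj₂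
  intercept₂ = proj₂ ∘ proj₂

  -- Equality of the points at position `x`, freed from residues: the differences of the coordinates
  -- are integers divisible by `p`, a form in which they can be combined linearly.
  record Meets (k l : Line) (x : Fin p) : Set where
    constructor meeting
    field
      second : pos p ∣ᶻ ((ι (intercept₁ k) -ᶻ ι (intercept₁ l)) +ᶻ ι x *ᶻ (ι (slope k) -ᶻ ι (slope l)))
      third  : pos p ∣ᶻ ((ι (intercept₂ k) -ᶻ ι (intercept₂ l)) +ᶻ
                 ι x *ᶻ (ι (slope k) *ᶻ ι (slope k) -ᶻ ι (slope l) *ᶻ ι (slope l)))

  encode-injective : ∀ k l → encode k ≡ encode l → k ≡ l
  encode-injective (y , u , v) (y′ , u′ , v′) eq with combine-injective y (combine u v) y′ (combine u′ v′) eq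
  ... | refl , eq′ with combine-injective u v u′ v′ eq′
  ... | refl , refl = refl

  point⇒meets : ∀ k l x → linePoint k x ≡ linePoint l x → Meets k l x
  point⇒meets (y , u , v) (y′ , u′ , v′) x eq = meeting
    (∣-cong (trans (cong₂ _-ᶻ_ (expand u (toℕ y)) (expand u′ (toℕ y′))) (ring (ι u) (ι u′) (ι x) (ι y) (ι y′)))
      (residue-≡ (toℕ u + toℕ x * toℕ y) (toℕ u′ + toℕ x * toℕ y′) (cong intercept₁ eq)))
    (∣-cong (trans (cong₂ _-ᶻ_ (expand² v y) (expand² v′ y′)) (ring (ι v) (ι v′) (ι x) (ι y *ᶻ ι y) (ι y′ *ᶻ ι y′)))
      (residue-≡ (toℕ v + toℕ x * (toℕ y * toℕ y)) (toℕ v′ + toℕ x * (toℕ y′ * toℕ y′)) (cong intercept₂ eq)))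
    where
    expand : ∀ (u : Fin p) z → pos (toℕ u + toℕ x * z) ≡ ι u +ᶻ ι x *ᶻ pos z
    expand u z = trans (ℤ.pos-+ (toℕ u) _) (cong (λ t → ι u +ᶻ t) (ℤ.pos-* (toℕ x) z))
    expand² : ∀ (v y : Fin p) → pos (toℕ v + toℕ x * (toℕ y * toℕ y)) ≡ ι v +ᶻ ι x *ᶻ (ι y *ᶻ ι y)
    expand² v y = trans (expand v (toℕ y * toℕ y)) (cong (λ t → ι v +ᶻ ι x *ᶻ t) (ℤ.pos-* (toℕ y) (toℕ y)))
    ring : ∀ u u′ x y y′ → (u +ᶻ x *ᶻ y) -ᶻ (u′ +ᶻ x *ᶻ y′) ≡ (u -ᶻ u′) +ᶻ x *ᶻ (y -ᶻ y′)
    ring = ℤ.solve-∀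

  parallel-meets⇒≡ : ∀ {k l} x → slope k ≡ slope l → Meets k l x → k ≡ l
  parallel-meets⇒≡ {y , u , v} {.y , u′ , v′} x refl (meeting b c)
    with ι-injective {u} {u′} (∣-cong (ring (ι u -ᶻ ι u′) (ι x) (ι y)) b)
       | ι-injective {v} {v′} (∣-cong (ring (ι v -ᶻ ι v′) (ι x) (ι y *ᶻ ι y)) c)
    where
    ring : ∀ a x y → a +ᶻ x *ᶻ (y -ᶻ y) ≡ a
    ring = ℤ.solve-∀
  ... | refl | refl = refl

  -- Subtracting the two second-coordinate conditions leaves (x - x′)(y - y′) divisible by `p`. The
  -- slopes therefore agree, and parallel lines that meet coincide.
  meetsTwice⇒≡ : ∀ {k l x x′} → x ≢ x′ → Meets k l x → Meets k l x′ → k ≡ l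
  meetsTwice⇒≡ {y , u , v} {y′ , u′ , v′} {x} {x′} x≢x′ m@(meeting b _) (meeting b′ _) =
    parallel-meets⇒≡ x (ι-injective (cancel (ι y -ᶻ ι y′) x≢x′
      (∣-cong (ring (ι u -ᶻ ι u′) (ι x) (ι x′) (ι y -ᶻ ι y′)) (ℤ.∣m∣n⇒∣m-n b b′)))) m
    where
    ring : ∀ a x x′ d → (a +ᶻ x *ᶻ d) -ᶻ (a +ᶻ x′ *ᶻ d) ≡ (x -ᶻ x′) *ᶻ d
    ring = ℤ.solve-∀

  -- Eliminating the intercepts leaves a linear system in the three differences of positions
  -- whose matrix is Vandermonde in the slopes.
  triangle-slopes : ∀ {k l m x y z} → Meets k m x → Meets k l y → Meets l m z →
    pos p ∣ᶻ ((ι x -ᶻ ι y) *ᶻ ((ι (slope k) -ᶻ ι (slope l)) *ᶻ (ι (slope k) -ᶻ ι (slope m))))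
  triangle-slopes {a , u , v} {b , u′ , v′} {c , u″ , v″} {x} {y} {z} (meeting e₁ f₁) (meeting e₂ f₂) (meeting e₃ f₃) =
    ∣-cong (ring (ι u) (ι u′) (ι u″) (ι v) (ι v′) (ι v″) (ι a) (ι b) (ι c) (ι x) (ι y) (ι z))
      (ℤ.∣m∣n⇒∣m-n (ℤ.∣m∣n⇒∣m-n (ℤ.∣m∣n⇒∣m-n f₁ f₂) f₃)
        -- Since b² - c² = (b + c)(b - c), the multiplier b + c cancels the terms in `z`.
        (ℤ.∣n⇒∣m*n (ι b +ᶻ ι c) (ℤ.∣m∣n⇒∣m-n (ℤ.∣m∣n⇒∣m-n e₁ e₂) e₃)))
    where
    ring : ∀ u u′ u″ v v′ v″ a b c x y z →
      ((((v -ᶻ v″) +ᶻ x *ᶻ (a *ᶻ a -ᶻ c *ᶻ c)) -ᶻ ((v -ᶻ v′) +ᶻ y *ᶻ (a *ᶻ a -ᶻ b *ᶻ b))) -ᶻ ((v′ -ᶻ v″) +ᶻ z *ᶻ (b *ᶻ b -ᶻ c *ᶻ c)))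
        -ᶻ (b +ᶻ c) *ᶻ ((((u -ᶻ u″) +ᶻ x *ᶻ (a -ᶻ c)) -ᶻ ((u -ᶻ u′) +ᶻ y *ᶻ (a -ᶻ b))) -ᶻ ((u′ -ᶻ u″) +ᶻ z *ᶻ (b -ᶻ c)))
      ≡ (x -ᶻ y) *ᶻ ((a -ᶻ b) *ᶻ (a -ᶻ c))
    ring = ℤ.solve-∀

  meets-sym : ∀ {k l x} → Meets k l x → Meets l k x
  meets-sym {y , u , v} {y′ , u′ , v′} {x} (meeting b c) = meeting
    (∣-cong (ring (ι u) (ι u′) (ι x) (ι y) (ι y′)) (ℤ.∣m⇒∣-m b))
    (∣-cong (ring (ι v) (ι v′) (ι x) (ι y *ᶻ ι y) (ι y′ *ᶻ ι y′)) (ℤ.∣m⇒∣-m c))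
    where
    ring : ∀ u u′ x y y′ → ℤ.- ((u -ᶻ u′) +ᶻ x *ᶻ (y -ᶻ y′)) ≡ (u′ -ᶻ u) +ᶻ x *ᶻ (y′ -ᶻ y)
    ring = ℤ.solve-∀

  twoSlopesEqual : ∀ {k l m x y z} → x ≢ y → Meets k m x → Meets k l y → Meets l m z →
    slope k ≡ slope l ⊎ slope k ≡ slope m
  twoSlopesEqual {k} {l} {m} {x} {y} {z} x≢y kmx kly lmz =
    Sum.map (ι-injective {slope k} {slope l}) (ι-injective {slope k} {slope m})
      (euclid (ι (slope k) -ᶻ ι (slope l)) (ι (slope k) -ᶻ ι (slope m))
        (cancel {x} {y} _ x≢y (triangle-slopes kmx kly lmz)))

  -- `twoSlopesEqual`, applied to the three rotations of the triangle, says that each slope equals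
  -- one of the other two. So all three are equal, and lines of equal slope that meet coincide.
  triangle⇒≡ : ∀ {k l m x y z} → x ≢ y → y ≢ z → z ≢ x → Meets k m x → Meets k l y → Meets l m z → k ≡ l × l ≡ m
  triangle⇒≡ {k} {l} {m} {x} {y} {z} x≢y y≢z z≢x kmx kly lmz =
    let k≡l , l≡m = slopes (twoSlopesEqual x≢y kmx kly lmz)
                           (twoSlopesEqual y≢z (meets-sym kly) lmz (meets-sym kmx))
                           (twoSlopesEqual z≢x (meets-sym lmz) (meets-sym kmx) kly)
    in parallel-meets⇒≡ y k≡l kly , parallel-meets⇒≡ z l≡m lmz
    where
    slopes : ∀ {a b c : Fin p} → a ≡ b ⊎ a ≡ c → b ≡ c ⊎ b ≡ a → c ≡ a ⊎ c ≡ b → a ≡ b × b ≡ c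
    slopes (inj₁ refl) _ (inj₁ refl) = refl , refl
    slopes (inj₁ refl) _ (inj₂ refl) = refl , refl
    slopes (inj₂ refl) (inj₁ refl) _ = refl , refl
    slopes (inj₂ refl) (inj₂ refl) _ = refl , refl

  primeSpace : TriangleFreeSpace (p * (p * p)) p (p * (p * p))
  primeSpace = record
    { point              = point
    ; position-unique    = λ {k} {l} eq → cong proj₁ (encode-injective (linePoint (decode k) _) (linePoint (decode l) _) eq)
    ; twoPointsDetermine = λ {k} {l} x≢y ex ey → decode-injective (meetsTwice⇒≡ x≢y (meets k l ex) (meets k l ey))
    ; noTriangle         = λ {k} {l} {m} x≢y y≢z z≢x ex ey ez →
        let k≡l , l≡m = triangle⇒≡ x≢y y≢z z≢x (meets k m ex) (meets k l ey) (meets l m ez)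
        in decode-injective k≡l , decode-injective l≡m
    }
    where
    point : Fin (p * (p * p)) → Fin p → Fin (p * (p * p))
    point l x = encode (linePoint (decode l) x)
    meets : ∀ k l {x} → point k x ≡ point l x → Meets (decode k) (decode l) x
    meets k l {x} eq = point⇒meets (decode k) (decode l) x (encode-injective _ _ eq)
    decode-injective : ∀ {k l} → decode k ≡ decode l → k ≡ l
    decode-injective {k} {l} eq = trans (sym (encode-decode k)) (trans (cong encode eq) (encode-decode l))

-- Colourings with small discrepancy on every line

sumFin : ∀ n → (Fin n → ℕ) → ℕ
sumFin zero    g = 0
sumFin (suc n) g = g zero + sumFin n (g ∘ suc)

prodFin : ∀ n → (Fin n → ℕ) → ℕ
prodFin zero    g = 1
prodFin (suc n) g = g zero * prodFin n (g ∘ suc)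

sumFin-cong : ∀ n {g h : Fin n → ℕ} → g ≗ h → sumFin n g ≡ sumFin n h
sumFin-cong zero    eq = refl
sumFin-cong (suc n) eq = cong₂ _+_ (eq zero) (sumFin-cong n (eq ∘ suc))

indicator : Bool → ℕ
indicator b = if b then 1 else 0

agreements disagreements : ∀ {p} → (Fin p → Bool) → (Fin p → Bool) → ℕ
agreements    {p} f c = sumFin p (λ x → indicator (not (f x xor c x)))
disagreements {p} f c = sumFin p (λ x → indicator (f x xor c x))

agreements+disagreements : ∀ {p} (f c : Fin p → Bool) → agreements f c + disagreements f c ≡ p
agreements+disagreements {zero} f c = refl
agreements+disagreements {suc p} f c with f zero xor c zero | agreements+disagreements (f ∘ suc) (c ∘ suc)
... | true  | eq = trans (+-suc _ _) (cong suc eq)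
... | false | eq = cong suc eq

rising : ℕ → ℕ → ℕ
rising a zero    = 1
rising a (suc k) = (a + k) * rising a k

-- The (unnormalised) probability that a Pólya urn started with α balls of each kind
-- produces the agreement pattern of f and c.
weight : ∀ {p} → ℕ → (Fin p → Bool) → (Fin p → Bool) → ℕ
weight α f c = rising α (agreements f c) * rising α (disagreements f c)

weight-cong : ∀ {p} α {f g : Fin p → Bool} c → f ≗ g → weight α f c ≡ weight α g c
weight-cong α c eq = cong₂ (λ a b → rising α a * rising α b)
  (sumFin-cong _ (λ x → cong (λ b → indicator (not (b xor c x))) (eq x)))
  (sumFin-cong _ (λ x → cong (λ b → indicator (b xor c x)) (eq x)))

-- The martingale property of the urn. Whatever `f` is at the new point, one colour adds an
-- agreement and the other a disagreement; the weight is multiplied by `α + A` and `α + B`, whose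
-- sum does not depend on `f` or `c`.
weight-split : ∀ {p} α (f : Fin (suc p) → Bool) (c : Fin p → Bool) →
  weight α f (true Vector.∷ c) + weight α f (false Vector.∷ c) ≡ (α + α + p) * weight α (f ∘ suc) c
weight-split {p} α f c = trans (cases (f zero)) (cong (λ k → (α + α + k) * (rising α A * rising α B)) (agreements+disagreements (f ∘ suc) c))
  where
  A B : ℕ
  A = agreements (f ∘ suc) c
  B = disagreements (f ∘ suc) c
  ring₁ : ∀ α A B x y → (α + A) * x * y + x * ((α + B) * y) ≡ (α + α + (A + B)) * (x * y)
  ring₁ = solve-∀
  ring₂ : ∀ α A B x y → x * ((α + B) * y) + (α + A) * x * y ≡ (α + α + (A + B)) * (x * y)
  ring₂ = solve-∀
  cases : ∀ b → rising α (indicator (not (b xor true)) + A) * rising α (indicator (b xor true) + B)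
              + rising α (indicator (not (b xor false)) + A) * rising α (indicator (b xor false) + B)
              ≡ (α + α + (A + B)) * (rising α A * rising α B)
  cases true  = ring₁ α A B _ _
  cases false = ring₂ α A B _ _

module _ {X : Set} where

  sumOver : List X → (X → ℕ) → ℕ
  sumOver xs g = sum (map g xs)

  sumOver-cong : ∀ xs {g h : X → ℕ} → g ≗ h → sumOver xs g ≡ sumOver xs h
  sumOver-cong []       eq = refl
  sumOver-cong (x ∷ xs) eq = cong₂ _+_ (eq x) (sumOver-cong xs eq)

  sumOver-+ : ∀ xs (g h : X → ℕ) → sumOver xs (λ x → g x + h x) ≡ sumOver xs g + sumOver xs h
  sumOver-+ []       g h = refl
  sumOver-+ (x ∷ xs) g h = trans (cong (g x + h x +_) (sumOver-+ xs g h)) (ring (g x) (h x) _ _)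
    where
    ring : ∀ a b c d → a + b + (c + d) ≡ a + c + (b + d)
    ring = solve-∀

  sumOver-* : ∀ xs k (g : X → ℕ) → sumOver xs (λ x → k * g x) ≡ k * sumOver xs g
  sumOver-* []       k g = sym (*-zeroʳ k)
  sumOver-* (x ∷ xs) k g = trans (cong (k * g x +_) (sumOver-* xs k g)) (sym (*-distribˡ-+ k (g x) _))

  sumOver-1 : ∀ xs → sumOver xs (λ _ → 1) ≡ length xs
  sumOver-1 []       = refl
  sumOver-1 (x ∷ xs) = cong suc (sumOver-1 xs)

  ∈⇒≤sumOver : ∀ {x xs} (g : X → ℕ) → x ∈ xs → g x ≤ sumOver xs g
  ∈⇒≤sumOver g (here refl) = m≤m+n _ _
  ∈⇒≤sumOver {xs = y ∷ _} g (there x∈) = ≤-trans (∈⇒≤sumOver g x∈) (m≤n+m _ (g y))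

halve : ∀ a b {c} → a + b ≡ c → 2 * a ≤ c ⊎ 2 * b ≤ c
halve a b refl with ≤-total a b
... | inj₁ a≤b = inj₁ (+-monoʳ-≤ a (≤-trans (≤-reflexive (+-identityʳ a)) a≤b))
... | inj₂ b≤a = inj₂ (+-mono-≤ b≤a (≤-reflexive (+-identityʳ b)))

module _ {X : Set} (xs : List X) (α : ℕ) where

  -- Conditional expectations, one point at a time: by `weight-split` the two possible colours have
  -- total `(α + α + p) * Σ₀`, so one of them has at most half. `W` carries the weight of the lines
  -- already coloured.
  lineColouring : ∀ p (W : X → ℕ) (val : X → Fin p → Bool) → ∃ λ (c : Fin p → Bool) →
    2 ^ p * sumOver xs (λ f → W f * weight α (val f) c) ≤ rising (α + α) p * sumOver xs W
  lineColouring zero W val = (λ ()) , ≤-reflexive (cong (1 *_) (sumOver-cong xs (λ f → *-identityʳ (W f))))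
  lineColouring (suc p) W val with lineColouring p W (λ f → val f ∘ suc)
  ... | c , bound = pick (halve (Σ′ true) (Σ′ false) split)
    where
    open ≤-Reasoning
    Σ′ : Bool → ℕ
    Σ′ b = sumOver xs (λ f → W f * weight α (val f) (b Vector.∷ c))
    Σ₀ : ℕ
    Σ₀ = sumOver xs (λ f → W f * weight α (val f ∘ suc) c)
    ring₁ : ∀ w a b → w * (a * b) ≡ a * (w * b)
    ring₁ = solve-∀
    ring₂ : ∀ t s → 2 * t * s ≡ t * (2 * s)
    ring₂ = solve-∀
    split : Σ′ true + Σ′ false ≡ (α + α + p) * Σ₀
    split = begin-equality
      Σ′ true + Σ′ false ≡⟨ sumOver-+ xs _ _ ⟨
      _ ≡⟨ sumOver-cong xs (λ f → trans (sym (*-distribˡ-+ (W f) (weight α (val f) (true Vector.∷ c)) _)) (cong (W f *_) (weight-split α (val f) c))) ⟩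
      _ ≡⟨ sumOver-cong xs (λ f → ring₁ (W f) (α + α + p) _) ⟩
      _ ≡⟨ sumOver-* xs (α + α + p) _ ⟩
      (α + α + p) * Σ₀ ∎
    extend : ∀ b → 2 * Σ′ b ≤ (α + α + p) * Σ₀ → 2 ^ suc p * Σ′ b ≤ rising (α + α) (suc p) * sumOver xs W
    extend b le = begin
      2 * 2 ^ p * Σ′ b ≡⟨ ring₂ (2 ^ p) (Σ′ b) ⟩
      2 ^ p * (2 * Σ′ b) ≤⟨ *-monoʳ-≤ (2 ^ p) le ⟩
      2 ^ p * ((α + α + p) * Σ₀) ≡⟨ ring₁ (2 ^ p) (α + α + p) Σ₀ ⟩
      (α + α + p) * (2 ^ p * Σ₀) ≤⟨ *-monoʳ-≤ (α + α + p) bound ⟩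
      (α + α + p) * (rising (α + α) p * sumOver xs W) ≡⟨ *-assoc (α + α + p) _ _ ⟨
      rising (α + α) (suc p) * sumOver xs W ∎
    pick : 2 * Σ′ true ≤ (α + α + p) * Σ₀ ⊎ 2 * Σ′ false ≤ (α + α + p) * Σ₀ → ∃ λ c →
      2 ^ suc p * sumOver xs (λ f → W f * weight α (val f) c) ≤ rising (α + α) (suc p) * sumOver xs W
    pick (inj₁ le) = true Vector.∷ c , extend true le
    pick (inj₂ le) = false Vector.∷ c , extend false le

  -- The lines are coloured in turn; the weight of the line just finished is multiplied into `W`
  -- before the next begins.
  colouring : ∀ N p (W : X → ℕ) (val : X → Fin N → Fin p → Bool) → ∃ λ (col : Fin N → Fin p → Bool) →
    (2 ^ p) ^ N * sumOver xs (λ f → W f * prodFin N (λ l → weight α (val f l) (col l)))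
      ≤ rising (α + α) p ^ N * sumOver xs W
  colouring zero p W val = (λ ()) , ≤-reflexive (cong (1 *_) (sumOver-cong xs (λ f → *-identityʳ (W f))))
  colouring (suc N) p W val =
    let c , bound = lineColouring p W (λ f → val f zero)
        col , bounds = colouring N p (λ f → W f * weight α (val f zero) c) (λ f → val f ∘ suc)
    in c Vector.∷ col , (begin
      2 ^ p * (2 ^ p) ^ N * sumOver xs (λ f → W f * (weight α (val f zero) c * prodFin N (λ l → weight α (val f (suc l)) (col l))))
        ≡⟨ cong (2 ^ p * (2 ^ p) ^ N *_) (sumOver-cong xs (λ f → sym (*-assoc (W f) (weight α (val f zero) c) _))) ⟩
      2 ^ p * (2 ^ p) ^ N * sumOver xs (λ f → W f * weight α (val f zero) c * prodFin N (λ l → weight α (val f (suc l)) (col l)))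
        ≡⟨ *-assoc (2 ^ p) ((2 ^ p) ^ N) _ ⟩
      _ ≤⟨ *-monoʳ-≤ (2 ^ p) bounds ⟩
      2 ^ p * (rising (α + α) p ^ N * sumOver xs (λ f → W f * weight α (val f zero) c))
        ≡⟨ ring (2 ^ p) (rising (α + α) p ^ N) _ ⟩
      rising (α + α) p ^ N * (2 ^ p * sumOver xs (λ f → W f * weight α (val f zero) c))
        ≤⟨ *-monoʳ-≤ (rising (α + α) p ^ N) bound ⟩
      rising (α + α) p ^ N * (rising (α + α) p * sumOver xs W)
        ≡⟨ ring′ (rising (α + α) p ^ N) (rising (α + α) p) _ ⟩
      rising (α + α) p * rising (α + α) p ^ N * sumOver xs W ∎)
    where
    open ≤-Reasoning
    ring : ∀ a b c → a * (b * c) ≡ b * (a * c)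
    ring = solve-∀
    ring′ : ∀ a b c → a * (b * c) ≡ b * a * c
    ring′ = solve-∀

allColourings : ∀ n → List (Fin n → Bool)
allColourings zero    = (λ ()) ∷ []
allColourings (suc n) = map (true Vector.∷_) (allColourings n) ++ map (false Vector.∷_) (allColourings n)

length-allColourings : ∀ n → length (allColourings n) ≡ 2 ^ n
length-allColourings zero    = refl
length-allColourings (suc n) = trans (length-++ (map (true Vector.∷_) (allColourings n)))
  (cong₂ _+_ (trans (length-map _ (allColourings n)) (length-allColourings n))
    (trans (trans (length-map _ (allColourings n)) (length-allColourings n)) (sym (+-identityʳ _))))

-- Pointwise equality replaces equality of functions, and `weight-cong` carries the weights across
-- it.
allColourings-complete : ∀ n (S : Fin n → Bool) → ∃ λ T → T ∈ allColourings n × T ≗ S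
allColourings-complete zero    S = (λ ()) , here refl , λ ()
allColourings-complete (suc n) S with S zero in eq | allColourings-complete n (S ∘ suc)
... | true  | T , T∈ , T≗S = true Vector.∷ T , ∈-++⁺ˡ (∈-map⁺ _ T∈) , λ { zero → sym eq ; (suc x) → T≗S x }
... | false | T , T∈ , T≗S = false Vector.∷ T , ∈-++⁺ʳ (map (true Vector.∷_) (allColourings n)) (∈-map⁺ _ T∈) , λ { zero → sym eq ; (suc x) → T≗S x }

-- Large imbalance forces large weight

-- This is d(d - 1)/2, the total of the exponents gained in `unbalanced` as the imbalance grows one
-- by one from 0 to `d`.
triangular : ℕ → ℕ
triangular zero    = 0
triangular (suc d) = triangular d + d

d≤2tri+1 : ∀ d → d ≤ 2 * triangular d + 1
d≤2tri+1 zero          = z≤n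
d≤2tri+1 (suc zero)    = s≤s z≤n
d≤2tri+1 (suc (suc d)) = begin
  2 + d                               ≡⟨ +-comm 1 (suc d) ⟩
  suc d + 1                           ≤⟨ +-monoˡ-≤ 1 (≤-trans (m≤n+m (suc d) (triangular (suc d))) (m≤n*m _ 2)) ⟩
  2 * (triangular (suc d) + suc d) + 1 ∎
  where open ≤-Reasoning

d*d≡2tri+d : ∀ d → d * d ≡ 2 * triangular d + d
d*d≡2tri+d zero    = refl
d*d≡2tri+d (suc d) = begin
  suc d * suc d                    ≡⟨ ring₁ d ⟩
  d * d + 2 * d + 1                ≡⟨ cong (λ s → s + 2 * d + 1) (d*d≡2tri+d d) ⟩
  2 * triangular d + d + 2 * d + 1 ≡⟨ ring₂ (triangular d) d ⟩
  2 * (triangular d + d) + suc d   ∎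
  where
  open ≡-Reasoning
  ring₁ : ∀ d → suc d * suc d ≡ d * d + 2 * d + 1
  ring₁ = solve-∀
  ring₂ : ∀ t d → 2 * t + d + 2 * d + 1 ≡ 2 * (t + d) + suc d
  ring₂ = solve-∀

d*d≤4tri+1 : ∀ d → d * d ≤ 4 * triangular d + 1
d*d≤4tri+1 d = begin
  d * d                                     ≡⟨ d*d≡2tri+d d ⟩
  2 * triangular d + d                      ≤⟨ +-monoʳ-≤ (2 * triangular d) (d≤2tri+1 d) ⟩
  2 * triangular d + (2 * triangular d + 1) ≡⟨ ring (triangular d) ⟩
  4 * triangular d + 1                      ∎
  where
  open ≤-Reasoning
  ring : ∀ t → 2 * t + (2 * t + 1) ≡ 4 * t + 1
  ring = solve-∀

bernoulli : ∀ y e → y ^ suc e + suc e * y ^ e ≤ suc y ^ suc e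
bernoulli y zero    = ≤-reflexive (ring y)
  where
  ring : ∀ y → y * 1 + 1 * 1 ≡ suc y * 1
  ring = solve-∀
bernoulli y (suc e) = begin
  y * (y * y ^ e) + (2 + e) * (y * y ^ e) ≤⟨ m≤m+n _ (suc e * y ^ e) ⟩
  y * (y * y ^ e) + (2 + e) * (y * y ^ e) + suc e * y ^ e ≡⟨ ring y e (y ^ e) ⟩
  suc y * (y * y ^ e + suc e * y ^ e)     ≤⟨ *-monoʳ-≤ (suc y) (bernoulli y e) ⟩
  suc y * suc y ^ suc e                   ∎
  where
  open ≤-Reasoning
  ring : ∀ y e t → y * (y * t) + (2 + e) * (y * t) + suc e * t ≡ suc y * (y * t + suc e * t)
  ring = solve-∀

2y^E≤ : ∀ y E → y < E → 2 * y ^ E ≤ suc y ^ E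
2y^E≤ y (suc e) y<E = begin
  2 * y ^ suc e               ≡⟨ cong (y ^ suc e +_) (+-identityʳ _) ⟩
  y ^ suc e + y * y ^ e       ≤⟨ +-monoʳ-≤ (y ^ suc e) (*-monoˡ-≤ (y ^ e) (<⇒≤ y<E)) ⟩
  y ^ suc e + suc e * y ^ e   ≤⟨ bernoulli y e ⟩
  suc y ^ suc e               ∎
  where open ≤-Reasoning

-- Each of the `d` unit steps from `D` to `D + d` at least doubles the `E`-th power, because the
-- base is below `E` before the step.
2^d*D^E≤ : ∀ D d E → D + d ≤ E → 2 ^ d * D ^ E ≤ (D + d) ^ E
2^d*D^E≤ D zero    E _  = ≤-reflexive (trans (*-identityˡ _) (cong (_^ E) (sym (+-identityʳ D))))
2^d*D^E≤ D (suc d) E le = begin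
  2 * 2 ^ d * D ^ E     ≡⟨ *-assoc 2 (2 ^ d) _ ⟩
  2 * (2 ^ d * D ^ E)   ≤⟨ *-monoʳ-≤ 2 (2^d*D^E≤ D d E (<⇒≤ D+d<E)) ⟩
  2 * (D + d) ^ E       ≤⟨ 2y^E≤ (D + d) E D+d<E ⟩
  suc (D + d) ^ E       ≡⟨ cong (_^ E) (+-suc D d) ⟨
  (D + suc d) ^ E       ∎
  where
  open ≤-Reasoning
  D+d<E : D + d < E
  D+d<E = ≤-trans (≤-reflexive (sym (+-suc D d))) le

-- Put X = α + B. One more agreement together with one more disagreement multiplies the rising
-- factorial on the left by 2X(2X + 1) and the scaled weight by 4X². The ratio (2X + 1)/(2X) is at
-- most (X + 1)/X, and these factors telescope to (α + B)/α.
balanced : ∀ α B → rising (α + α) (B + B) * (2 * α) ≤ 2 ^ (B + B) * (rising α B * rising α B) * (2 * (α + B))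
balanced α zero    = ≤-reflexive (cong (λ k → 1 * (2 * k)) (sym (+-identityʳ α)))
balanced α (suc B) rewrite +-suc B B = begin
  (α + α + suc (B + B)) * ((α + α + (B + B)) * r) * (2 * α)        ≡⟨ ring₁ α B r ⟩
  (X + X + 1) * (X + X) * (r * (2 * α))                            ≤⟨ *-monoʳ-≤ ((X + X + 1) * (X + X)) (balanced α B) ⟩
  (X + X + 1) * (X + X) * (2 ^ (B + B) * (x * x) * (2 * X))        ≤⟨ *-monoˡ-≤ (2 ^ (B + B) * (x * x) * (2 * X)) (*-monoˡ-≤ (X + X) (+-monoʳ-≤ (X + X) (s≤s {n = 1} z≤n))) ⟩
  (X + X + 2) * (X + X) * (2 ^ (B + B) * (x * x) * (2 * X))        ≡⟨ ring₂ α B (2 ^ (B + B)) x ⟩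
  2 * (2 * 2 ^ (B + B)) * (X * x * (X * x)) * (2 * (α + suc B))    ∎
  where
  open ≤-Reasoning
  X r x : ℕ
  X = α + B
  r = rising (α + α) (B + B)
  x = rising α B
  ring₁ : ∀ α B r → (α + α + suc (B + B)) * ((α + α + (B + B)) * r) * (2 * α)
    ≡ (α + B + (α + B) + 1) * (α + B + (α + B)) * (r * (2 * α))
  ring₁ = solve-∀
  ring₂ : ∀ α B P x → (α + B + (α + B) + 2) * (α + B + (α + B)) * (P * (x * x) * (2 * (α + B)))
    ≡ 2 * (2 * P) * ((α + B) * x * ((α + B) * x)) * (2 * (α + suc B))
  ring₂ = solve-∀

-- Induction on the imbalance. A further point on the heavier side multiplies the rising factorial
-- on the left by D = 2α + 2B + d and the scaled weight by 2(α + B + d) = D + d; after raising to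
-- the power `E` this gains 2^d. In the balanced case (α + B)/α is at most 2, whence the `suc` in
-- the exponent of 2.
unbalanced : ∀ α B d E → 0 < α → B ≤ α → 2 * (α + B + d) ≤ E →
  rising (α + α) (B + B + d) ^ E * 2 ^ triangular d ≤ (2 ^ suc (B + B + d) * (rising α (B + d) * rising α B)) ^ E
unbalanced α B zero E 0<α B≤α _ rewrite +-identityʳ (B + B) | +-identityʳ B =
  ≤-trans (≤-reflexive (*-identityʳ _)) (^-monoˡ-≤ E (*-cancelʳ-≤ _ _ (2 * α) (begin
    rising (α + α) (B + B) * (2 * α)              ≤⟨ balanced α B ⟩
    2 ^ (B + B) * (x * x) * (2 * (α + B))         ≤⟨ *-monoʳ-≤ (2 ^ (B + B) * (x * x)) (*-monoʳ-≤ 2 (+-monoʳ-≤ α B≤α)) ⟩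
    2 ^ (B + B) * (x * x) * (2 * (α + α))         ≡⟨ ring (2 ^ (B + B)) x α ⟩
    2 * 2 ^ (B + B) * (x * x) * (2 * α)           ∎)))
  where
  open ≤-Reasoning
  x : ℕ
  x = rising α B
  instance
    2α≢0 : NonZero (2 * α)
    2α≢0 = >-nonZero (≤-trans 0<α (m≤n*m α 2))
  ring : ∀ P x α → P * (x * x) * (2 * (α + α)) ≡ 2 * P * (x * x) * (2 * α)
  ring = solve-∀
unbalanced α B (suc d) E 0<α B≤α le rewrite +-suc (B + B) d | +-suc B d = begin
  (D * r) ^ E * 2 ^ (triangular d + d)          ≡⟨ cong₂ _*_ (^-distribʳ-* D r E) (^-distribˡ-+-* 2 (triangular d) d) ⟩
  D ^ E * r ^ E * (2 ^ triangular d * 2 ^ d)    ≡⟨ ring₁ (D ^ E) (r ^ E) (2 ^ triangular d) (2 ^ d) ⟩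
  2 ^ d * D ^ E * (r ^ E * 2 ^ triangular d)    ≤⟨ *-mono-≤ (2^d*D^E≤ D d E D+d≤E) (unbalanced α B d E 0<α B≤α le′) ⟩
  (D + d) ^ E * (2 ^ suc (B + B + d) * (x * y)) ^ E ≡⟨ ^-distribʳ-* (D + d) (2 ^ suc (B + B + d) * (x * y)) E ⟨
  ((D + d) * (2 ^ suc (B + B + d) * (x * y))) ^ E ≡⟨ cong (_^ E) (ring₂ α B d (2 ^ suc (B + B + d)) x y) ⟩
  (2 * 2 ^ suc (B + B + d) * ((α + (B + d)) * x * y)) ^ E ∎
  where
  open ≤-Reasoning
  D r x y : ℕ
  D = α + α + (B + B + d)
  r = rising (α + α) (B + B + d)
  x = rising α (B + d)
  y = rising α B
  ring₁ : ∀ a b c d → a * b * (c * d) ≡ d * a * (b * c)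
  ring₁ = solve-∀
  ring₂ : ∀ α B d P x y → (α + α + (B + B + d) + d) * (P * (x * y)) ≡ 2 * P * ((α + (B + d)) * x * y)
  ring₂ = solve-∀
  ring₃ : ∀ α B d → α + α + (B + B + d) + d ≡ 2 * (α + B + d)
  ring₃ = solve-∀
  le′ : 2 * (α + B + d) ≤ E
  le′ = ≤-trans (*-monoʳ-≤ 2 (+-monoʳ-≤ (α + B) (n≤1+n d))) le
  D+d≤E : D + d ≤ E
  D+d≤E = ≤-trans (≤-reflexive (ring₃ α B d)) le′

-- The urn starts with `p` balls of each kind. As `B + d ≤ p`, the exponent `4 * p` is at least 2(p
-- + B + d), and `B ≤ p` limits the loss in the balanced part.
lineBound-≤ : ∀ p B d → B + B + d ≡ p → 0 < p →
  rising (p + p) p ^ (4 * p) * 2 ^ triangular d ≤ (2 ^ suc p * (rising p (B + d) * rising p B)) ^ (4 * p)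
lineBound-≤ p B d eq 0<p = subst
  (λ k → rising (p + p) k ^ (4 * p) * 2 ^ triangular d ≤ (2 ^ suc k * (rising p (B + d) * rising p B)) ^ (4 * p)) eq
  (unbalanced p B d (4 * p) 0<p B≤p (≤-trans (*-monoʳ-≤ 2 p+B+d≤p+p) (≤-reflexive (ring p))))
  where
  ring : ∀ p → 2 * (p + p) ≡ 4 * p
  ring = solve-∀
  B≤p : B ≤ p
  B≤p = subst (B ≤_) eq (≤-trans (m≤m+n B B) (m≤m+n (B + B) d))
  p+B+d≤p+p : p + B + d ≤ p + p
  p+B+d≤p+p = ≤-trans (≤-reflexive (+-assoc p B d)) (+-monoʳ-≤ p (subst (B + d ≤_) eq (+-monoˡ-≤ d (m≤m+n B B))))

lineBound : ∀ p A B → A + B ≡ p → 0 < p →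
  rising (p + p) p ^ (4 * p) * 2 ^ triangular ∣ A - B ∣ ≤ (2 ^ suc p * (rising p A * rising p B)) ^ (4 * p)
lineBound p A B eq 0<p with ≤-total B A
... | inj₁ B≤A rewrite m≤n⇒∣n-m∣≡n∸m B≤A =
  subst (λ a → rising (p + p) p ^ (4 * p) * 2 ^ triangular (A ∸ B) ≤ (2 ^ suc p * (rising p a * rising p B)) ^ (4 * p))
    (m+[n∸m]≡n B≤A) (lineBound-≤ p B (A ∸ B) (trans (trans (+-assoc B B _) (trans (cong (B +_) (m+[n∸m]≡n B≤A)) (+-comm B A))) eq) 0<p)
... | inj₂ A≤B rewrite m≤n⇒∣m-n∣≡n∸m A≤B | *-comm (rising p A) (rising p B) =
  subst (λ b → rising (p + p) p ^ (4 * p) * 2 ^ triangular (B ∸ A) ≤ (2 ^ suc p * (rising p b * rising p A)) ^ (4 * p))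
    (m+[n∸m]≡n A≤B) (lineBound-≤ p A (B ∸ A) (trans (trans (+-assoc A A _) (cong (A +_) (m+[n∸m]≡n A≤B))) eq) 0<p)

prodFin-cong : ∀ N {g h : Fin N → ℕ} → g ≗ h → prodFin N g ≡ prodFin N h
prodFin-cong zero    eq = refl
prodFin-cong (suc N) eq = cong₂ _*_ (eq zero) (prodFin-cong N (eq ∘ suc))

prodFin-mono : ∀ N {g h : Fin N → ℕ} → (∀ l → g l ≤ h l) → prodFin N g ≤ prodFin N h
prodFin-mono zero    le = ≤-refl
prodFin-mono (suc N) le = *-mono-≤ (le zero) (prodFin-mono N (le ∘ suc))

prodFin-* : ∀ N k (g : Fin N → ℕ) → prodFin N (λ l → k * g l) ≡ k ^ N * prodFin N g
prodFin-* zero    k g = refl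
prodFin-* (suc N) k g = trans (cong (k * g zero *_) (prodFin-* N k (g ∘ suc))) (ring k (g zero) _ _)
  where
  ring : ∀ a b c d → a * b * (c * d) ≡ a * c * (b * d)
  ring = solve-∀

prodFin-^ : ∀ N E (g : Fin N → ℕ) → prodFin N (λ l → g l ^ E) ≡ prodFin N g ^ E
prodFin-^ zero    E g = sym (^-zeroˡ E)
prodFin-^ (suc N) E g = trans (cong (g zero ^ E *_) (prodFin-^ N E (g ∘ suc))) (sym (^-distribʳ-* (g zero) _ E))

prodFin-2^ : ∀ N (g : Fin N → ℕ) → prodFin N (λ l → 2 ^ g l) ≡ 2 ^ sumFin N g
prodFin-2^ zero    g = refl
prodFin-2^ (suc N) g = trans (cong (2 ^ g zero *_) (prodFin-2^ N (g ∘ suc))) (sym (^-distribˡ-+-* 2 (g zero) _))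

rising≢0 : ∀ a k → 0 < a → NonZero (rising a k)
rising≢0 a zero    _   = _
rising≢0 a (suc k) 0<a = m*n≢0 (a + k) (rising a k) {{>-nonZero (≤-trans 0<a (m≤m+n a k))}} {{rising≢0 a k 0<a}}

2^-cancel-≤ : ∀ a b → 2 ^ a ≤ 2 ^ b → a ≤ b
2^-cancel-≤ a b le = ≮⇒≥ λ b<a → <⇒≱ (^-monoʳ-< 2 (s≤s (s≤s z≤n)) b<a) le

imbalance : ∀ {p} → (Fin p → Bool) → (Fin p → Bool) → ℕ
imbalance f c = ∣ agreements f c - disagreements f c ∣

-- The weights summed over all 2^n sets stay within the bound of `colouring`, and each set
-- contributes a single term. Multiplying `lineBound` over the lines and cancelling `Q ^ E` leaves a
-- comparison of exponents of 2: `n` comes from the number of sets, `N` from the factor 2 lost on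
-- each line.
lowDiscrepancy : ∀ {n} N p → 0 < p → (pt : Fin N → Fin p → Fin n) →
  ∃ λ (col : Fin N → Fin p → Bool) → ∀ (S : Fin n → Bool) →
    sumFin N (λ l → triangular (imbalance (S ∘ pt l) (col l))) ≤ (N + n) * (4 * p)
lowDiscrepancy {n} N p 0<p pt with colouring (allColourings n) p N p (λ _ → 1) (λ S l → S ∘ pt l)
... | col , bound = col , discrepancy
  where
  open ≤-Reasoning
  E Q : ℕ
  E = 4 * p
  Q = rising (p + p) p ^ N
  instance
    Q^E≢0 : NonZero (Q ^ E)
    Q^E≢0 = m^n≢0 Q E {{m^n≢0 _ N {{rising≢0 (p + p) p (≤-trans 0<p (m≤m+n p p))}}}}
  Π : (Fin n → Bool) → ℕ
  Π S = prodFin N (λ l → weight p (S ∘ pt l) (col l))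
  weights : ∀ S → (2 ^ p) ^ N * Π S ≤ Q * 2 ^ n
  weights S = let T , T∈ , T≗S = allColourings-complete n S in begin
    (2 ^ p) ^ N * Π S       ≡⟨ cong ((2 ^ p) ^ N *_) (prodFin-cong N (λ l → weight-cong p (col l) (λ x → sym (T≗S (pt l x))))) ⟩
    (2 ^ p) ^ N * Π T       ≡⟨ cong ((2 ^ p) ^ N *_) (*-identityˡ (Π T)) ⟨
    (2 ^ p) ^ N * (1 * Π T) ≤⟨ *-monoʳ-≤ ((2 ^ p) ^ N) (∈⇒≤sumOver (λ T → 1 * Π T) T∈) ⟩
    _                       ≤⟨ bound ⟩
    Q * sumOver (allColourings n) (λ _ → 1) ≡⟨ cong (Q *_) (trans (sumOver-1 (allColourings n)) (length-allColourings n)) ⟩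
    Q * 2 ^ n               ∎
  discrepancy : ∀ S → sumFin N (λ l → triangular (imbalance (S ∘ pt l) (col l))) ≤ (N + n) * E
  discrepancy S = 2^-cancel-≤ T ((N + n) * E) (*-cancelˡ-≤ (Q ^ E) (begin
    Q ^ E * 2 ^ T                                             ≡⟨ cong₂ _*_ Q^E≡ (sym (prodFin-2^ N t)) ⟩
    (rising (p + p) p ^ E) ^ N * prodFin N (λ l → 2 ^ t l)    ≡⟨ prodFin-* N (rising (p + p) p ^ E) (λ l → 2 ^ t l) ⟨
    prodFin N (λ l → rising (p + p) p ^ E * 2 ^ t l)          ≤⟨ prodFin-mono N (λ l → lineBound p (agreements (S ∘ pt l) (col l)) (disagreements (S ∘ pt l) (col l)) (agreements+disagreements (S ∘ pt l) (col l)) 0<p) ⟩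
    prodFin N (λ l → (2 ^ suc p * w l) ^ E)                   ≡⟨ prodFin-^ N E (λ l → 2 ^ suc p * w l) ⟩
    prodFin N (λ l → 2 ^ suc p * w l) ^ E                     ≡⟨ cong (_^ E) (prodFin-* N (2 ^ suc p) w) ⟩
    ((2 * 2 ^ p) ^ N * Π S) ^ E                               ≡⟨ cong (λ k → (k * Π S) ^ E) (^-distribʳ-* 2 (2 ^ p) N) ⟩
    (2 ^ N * (2 ^ p) ^ N * Π S) ^ E                           ≡⟨ cong (_^ E) (*-assoc (2 ^ N) ((2 ^ p) ^ N) (Π S)) ⟩
    (2 ^ N * ((2 ^ p) ^ N * Π S)) ^ E                         ≤⟨ ^-monoˡ-≤ E (*-monoʳ-≤ (2 ^ N) (weights S)) ⟩
    (2 ^ N * (Q * 2 ^ n)) ^ E                                 ≡⟨ cong (_^ E) (ring (2 ^ N) Q (2 ^ n)) ⟩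
    (Q * (2 ^ N * 2 ^ n)) ^ E                                 ≡⟨ cong (λ k → (Q * k) ^ E) (^-distribˡ-+-* 2 N n) ⟨
    (Q * 2 ^ (N + n)) ^ E                                     ≡⟨ ^-distribʳ-* Q (2 ^ (N + n)) E ⟩
    Q ^ E * (2 ^ (N + n)) ^ E                                 ≡⟨ cong (Q ^ E *_) (^-*-assoc 2 (N + n) E) ⟩
    Q ^ E * 2 ^ ((N + n) * E)                                 ∎))
    where
    t w : Fin N → ℕ
    t l = triangular (imbalance (S ∘ pt l) (col l))
    w l = weight p (S ∘ pt l) (col l)
    T : ℕ
    T = sumFin N t
    Q^E≡ : Q ^ E ≡ (rising (p + p) p ^ E) ^ N
    Q^E≡ = trans (^-*-assoc (rising (p + p) p) N E) (trans (cong (rising (p + p) p ^_) (*-comm N E)) (sym (^-*-assoc _ E N)))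
    ring : ∀ a b c → a * (b * c) ≡ b * (a * c)
    ring = solve-∀

-- The digraph of a coloured space

relabel : ∀ {k n} → (Fin k → Fin n) → Arcs k → Arcs n
relabel q = map (λ { (t , h) → q t , q h })

dicutSize-relabel : ∀ {k n} (q : Fin k → Fin n) S A → dicutSize S (relabel q A) ≡ dicutSize (S ∘ q) A
dicutSize-relabel q S []            = refl
dicutSize-relabel q S ((t , h) ∷ A) = cong (_ +_) (dicutSize-relabel q S A)

dicutSize-++ : ∀ {n} S (A B : Arcs n) → dicutSize S (A ++ B) ≡ dicutSize S A + dicutSize S B
dicutSize-++ S []            B = refl
dicutSize-++ S ((t , h) ∷ A) B = trans (cong (_ +_) (dicutSize-++ S A B)) (sym (+-assoc (if S t ∧ not (S h) then 1 else 0) _ _))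

dicutSize-true : ∀ {n} (A : Arcs n) → dicutSize (λ _ → true) A ≡ 0
dicutSize-true []      = refl
dicutSize-true (_ ∷ A) = dicutSize-true A

dicutSize≤length : ∀ {n} S (A : Arcs n) → dicutSize S A ≤ length A
dicutSize≤length S []            = z≤n
dicutSize≤length S ((t , h) ∷ A) with S t ∧ not (S h)
... | true  = s≤s (dicutSize≤length S A)
... | false = m≤n⇒m≤1+n (dicutSize≤length S A)

dicutSize-concat : ∀ {n} N S (F : Fin N → Arcs n) → dicutSize S (concat (tabulate F)) ≡ sumFin N (dicutSize S ∘ F)
dicutSize-concat zero    S F = refl
dicutSize-concat (suc N) S F = trans (dicutSize-++ S (F zero) _) (cong (dicutSize S (F zero) +_) (dicutSize-concat N S (F ∘ suc)))

length-concat : ∀ {n} N (F : Fin N → Arcs n) → length (concat (tabulate F)) ≡ sumFin N (length ∘ F)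
length-concat zero    F = refl
length-concat (suc N) F = trans (length-++ (F zero)) (cong (length (F zero) +_) (length-concat N (F ∘ suc)))

count : ∀ {A : Set} → (A → Bool) → List A → ℕ
count S []       = 0
count S (x ∷ xs) = indicator (S x) + count S xs

count+count-not : ∀ {A : Set} (S : A → Bool) xs → count S xs + count (not ∘ S) xs ≡ length xs
count+count-not S []       = refl
count+count-not S (x ∷ xs) with S x
... | true  = cong suc (count+count-not S xs)
... | false = trans (+-suc (count S xs) _) (cong suc (count+count-not S xs))

count-none : ∀ {A : Set} (xs : List A) → count (λ _ → false) xs ≡ 0
count-none []       = refl
count-none (x ∷ xs) = count-none xs

dicutSize-product : ∀ {n} S (xs ys : List (Fin n)) →
  dicutSize S (cartesianProduct xs ys) ≡ count S xs * count (not ∘ S) ys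
dicutSize-product S []       ys = refl
dicutSize-product S (x ∷ xs) ys = begin
  dicutSize S (map (x ,_) ys ++ cartesianProduct xs ys)           ≡⟨ dicutSize-++ S (map (x ,_) ys) _ ⟩
  dicutSize S (map (x ,_) ys) + dicutSize S (cartesianProduct xs ys) ≡⟨ cong₂ _+_ (star ys) (dicutSize-product S xs ys) ⟩
  indicator (S x) * count (not ∘ S) ys + count S xs * count (not ∘ S) ys ≡⟨ *-distribʳ-+ (count (not ∘ S) ys) (indicator (S x)) _ ⟨
  count S (x ∷ xs) * count (not ∘ S) ys                           ∎
  where
  open ≡-Reasoning
  indicator-∧ : ∀ a b → indicator (a ∧ b) ≡ indicator a * indicator b
  indicator-∧ true  b = sym (+-identityʳ _)
  indicator-∧ false b = refl
  star : ∀ ys → dicutSize S (map (x ,_) ys) ≡ indicator (S x) * count (not ∘ S) ys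
  star []       = sym (*-zeroʳ (indicator (S x)))
  star (y ∷ ys) = trans (cong₂ _+_ (indicator-∧ (S x) (not (S y))) (star ys)) (sym (*-distribˡ-+ (indicator (S x)) (indicator (not (S y))) _))

length-product : ∀ {A B : Set} (xs : List A) (ys : List B) → length (cartesianProduct xs ys) ≡ length xs * length ys
length-product []       ys = refl
length-product (x ∷ xs) ys = trans (length-++ (map (x ,_) ys)) (cong₂ _+_ (length-map (x ,_) ys) (length-product xs ys))

class : ∀ {p} → (Fin p → Bool) → Bool → List (Fin p)
class c b = filter (λ x → c x Bool.≟ b) (allFin _)

count-class : ∀ {p} (S c : Fin p → Bool) →
  (agreements S c ≡ count S (class c true) + count (not ∘ S) (class c false)) ×
  (disagreements S c ≡ count (not ∘ S) (class c true) + count S (class c false))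
-- The induction is over an arbitrary `g`, since the tail of the tabulated identity is no longer an
-- identity.
count-class {p} S c = go p (λ x → x)
  where
  side : ∀ {k} → (Fin k → Fin p) → Bool → List (Fin p)
  side g b = filter (λ x → c x Bool.≟ b) (tabulate g)
  go : ∀ k (g : Fin k → Fin p) →
    (sumFin k (λ i → indicator (not (S (g i) xor c (g i)))) ≡ count S (side g true) + count (not ∘ S) (side g false)) ×
    (sumFin k (λ i → indicator (S (g i) xor c (g i))) ≡ count (not ∘ S) (side g true) + count S (side g false))
  go zero    g = refl , refl
  go (suc k) g with c (g zero) | S (g zero) in eq | go k (g ∘ suc)
  ... | true  | true  | e , e′ rewrite eq = cong suc e , e′
  ... | true  | false | e , e′ rewrite eq = e , cong suc e′
  ... | false | true  | e , e′ rewrite eq = e , trans (cong suc e′) (sym (+-suc (count (not ∘ S) (side (g ∘ suc) true)) _))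
  ... | false | false | e , e′ rewrite eq = trans (cong suc e) (sym (+-suc (count S (side (g ∘ suc) true)) _)) , e′

bichromatic : ∀ {p} → (Fin p → Bool) → Arcs p
bichromatic c = cartesianProduct (class c true) (class c false) ++ cartesianProduct (class c false) (class c true)

∈-class⁻ : ∀ {p} (c : Fin p → Bool) b {x} → x ∈ class c b → c x ≡ b
∈-class⁻ c b x∈ = proj₂ (∈-filter⁻ (λ x → c x Bool.≟ b) {xs = allFin _} x∈)

∈-product⁻ : ∀ {p} (c : Fin p → Bool) b b′ {x y} → (x , y) ∈ cartesianProduct (class c b) (class c b′) → c x ≡ b × c y ≡ b′
∈-product⁻ c b b′ xy∈ = let x∈ , y∈ = ∈-cartesianProduct⁻ (class c b) (class c b′) xy∈ in ∈-class⁻ c b x∈ , ∈-class⁻ c b′ y∈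

∈-bichromatic⁻ : ∀ {p} (c : Fin p → Bool) {x y} → (x , y) ∈ bichromatic c → c x ≢ c y
∈-bichromatic⁻ c xy∈ cx≡cy with ∈-++⁻ (cartesianProduct (class c true) (class c false)) xy∈
... | inj₁ xy∈tf = let cx , cy = ∈-product⁻ c true false xy∈tf in contradiction (trans (sym cx) (trans cx≡cy cy)) λ ()
... | inj₂ xy∈ft = let cx , cy = ∈-product⁻ c false true xy∈ft in contradiction (trans (sym cx) (trans cx≡cy cy)) λ ()

bichromatic-unique : ∀ {p} (c : Fin p → Bool) → Unique (bichromatic c)
bichromatic-unique c = Unique.++⁺
  (Unique.cartesianProduct⁺ (class-unique true) (class-unique false))
  (Unique.cartesianProduct⁺ (class-unique false) (class-unique true))
  λ { {x , y} (xy∈ , xy∈′) → contradiction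
    (trans (sym (proj₁ (∈-product⁻ c true false xy∈))) (proj₁ (∈-product⁻ c false true xy∈′))) λ () }
  where
  class-unique : ∀ b → Unique (class c b)
  class-unique b = Unique.filter⁺ (λ x → c x Bool.≟ b) (Unique.allFin⁺ _)

m²+n²≡2mn+∣m-n∣² : ∀ m n → m * m + n * n ≡ 2 * (m * n) + ∣ m - n ∣ * ∣ m - n ∣
m²+n²≡2mn+∣m-n∣² zero    n       = refl
m²+n²≡2mn+∣m-n∣² (suc m) zero    = ring m
  where
  ring : ∀ m → suc m * suc m + 0 ≡ 2 * (suc m * 0) + suc m * suc m
  ring = solve-∀
m²+n²≡2mn+∣m-n∣² (suc m) (suc n) = begin
  suc m * suc m + suc n * suc n                       ≡⟨ ring₁ m n ⟩
  (m * m + n * n) + 2 * (m + n + 1)                   ≡⟨ cong (_+ 2 * (m + n + 1)) (m²+n²≡2mn+∣m-n∣² m n) ⟩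
  2 * (m * n) + ∣ m - n ∣ * ∣ m - n ∣ + 2 * (m + n + 1) ≡⟨ ring₂ m n (∣ m - n ∣ * ∣ m - n ∣) ⟩
  2 * (suc m * suc n) + ∣ m - n ∣ * ∣ m - n ∣         ∎
  where
  open ≡-Reasoning
  ring₁ : ∀ m n → suc m * suc m + suc n * suc n ≡ (m * m + n * n) + 2 * (m + n + 1)
  ring₁ = solve-∀
  ring₂ : ∀ m n d → 2 * (m * n) + d + 2 * (m + n + 1) ≡ 2 * (suc m * suc n) + d
  ring₂ = solve-∀

-- The two colour classes exhaust the line, so this is the difference between the numbers of its
-- points inside and outside `S`.
surplus : ∀ {p} → (Fin p → Bool) → (Fin p → Bool) → ℕ
surplus S c = ∣ count S (class c true) + count S (class c false) - count (not ∘ S) (class c true) + count (not ∘ S) (class c false) ∣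

-- Adding 2AB + 2UW to both sides turns this into a polynomial identity in the sizes a, a′, b, b′
-- of the four cells cut out by S and c.
line-dicut : ∀ {p} (S c : Fin p → Bool) →
  8 * dicutSize S (bichromatic c) + surplus S c * surplus S c ≡ 2 * length (bichromatic c) + imbalance S c * imbalance S c
line-dicut {p} S c = +-cancelˡ-≡ (2 * (A * B) + 2 * (U * W)) _ _ (begin
  2 * (A * B) + 2 * (U * W) + (8 * dicutSize S (bichromatic c) + ∣ U - W ∣ * ∣ U - W ∣)
    ≡⟨ cong (λ d → 2 * (A * B) + 2 * (U * W) + (8 * d + ∣ U - W ∣ * ∣ U - W ∣)) dicut≡ ⟩
  2 * (A * B) + 2 * (U * W) + (8 * (a * b′ + b * a′) + ∣ U - W ∣ * ∣ U - W ∣)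
    ≡⟨ ring₁ (2 * (A * B)) (2 * (U * W)) (a * b′ + b * a′) (∣ U - W ∣ * ∣ U - W ∣) ⟩
  2 * (A * B) + 8 * (a * b′ + b * a′) + (2 * (U * W) + ∣ U - W ∣ * ∣ U - W ∣)
    ≡⟨ cong₂ (λ s t → 2 * s + 8 * (a * b′ + b * a′) + t) (cong₂ _*_ A≡ B≡) (sym (m²+n²≡2mn+∣m-n∣² U W)) ⟩
  2 * ((a + b′) * (a′ + b)) + 8 * (a * b′ + b * a′) + (U * U + W * W)
    ≡⟨ ring₂ a a′ b b′ ⟩
  2 * ((a + a′) * (b + b′) + (b + b′) * (a + a′)) + 2 * (U * W) + ((a + b′) * (a + b′) + (a′ + b) * (a′ + b))
    ≡⟨ cong₂ (λ s t → 2 * s + 2 * (U * W) + t) (sym length≡)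
         (trans (sym (cong₂ _+_ (cong₂ _*_ A≡ A≡) (cong₂ _*_ B≡ B≡))) (m²+n²≡2mn+∣m-n∣² A B)) ⟩
  2 * length (bichromatic c) + 2 * (U * W) + (2 * (A * B) + imbalance S c * imbalance S c)
    ≡⟨ ring₃ (2 * length (bichromatic c)) (2 * (U * W)) (2 * (A * B)) _ ⟩
  2 * (A * B) + 2 * (U * W) + (2 * length (bichromatic c) + imbalance S c * imbalance S c) ∎)
  where
  open ≡-Reasoning
  T F : List (Fin p)
  T = class c true
  F = class c false
  a a′ b b′ A B U W : ℕ
  a  = count S T
  a′ = count (not ∘ S) T
  b  = count S F
  b′ = count (not ∘ S) F
  A  = agreements S c
  B  = disagreements S c
  U  = a + b
  W  = a′ + b′
  A≡ : A ≡ a + b′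
  A≡ = proj₁ (count-class S c)
  B≡ : B ≡ a′ + b
  B≡ = proj₂ (count-class S c)
  dicut≡ : dicutSize S (bichromatic c) ≡ a * b′ + b * a′
  dicut≡ = trans (dicutSize-++ S (cartesianProduct T F) _) (cong₂ _+_ (dicutSize-product S T F) (dicutSize-product S F T))
  length≡ : length (bichromatic c) ≡ (a + a′) * (b + b′) + (b + b′) * (a + a′)
  length≡ = trans (length-++ (cartesianProduct T F)) (cong₂ _+_
    (trans (length-product T F) (cong₂ _*_ (sym (count+count-not S T)) (sym (count+count-not S F))))
    (trans (length-product F T) (cong₂ _*_ (sym (count+count-not S F)) (sym (count+count-not S T)))))
  ring₁ : ∀ x y z w → x + y + (8 * z + w) ≡ x + 8 * z + (y + w)
  ring₁ = solve-∀
  ring₂ : ∀ a a′ b b′ → 2 * ((a + b′) * (a′ + b)) + 8 * (a * b′ + b * a′) + ((a + b) * (a + b) + (a′ + b′) * (a′ + b′))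
    ≡ 2 * ((a + a′) * (b + b′) + (b + b′) * (a + a′)) + 2 * ((a + b) * (a′ + b′)) + ((a + b′) * (a + b′) + (a′ + b) * (a′ + b))
  ring₂ = solve-∀
  ring₃ : ∀ x y z w → x + y + (z + w) ≡ z + y + (x + w)
  ring₃ = solve-∀

-- In `line-dicut` let `S` contain every point: the dicut vanishes and the surplus is `p`.
line-size : ∀ {p} (c : Fin p → Bool) → p * p ≡ 2 * length (bichromatic c) + imbalance (λ _ → true) c * imbalance (λ _ → true) c
line-size {p} c = begin
  p * p                                  ≡⟨ cong₂ _*_ p≡ p≡ ⟩
  surplus all c * surplus all c          ≡⟨ cong (λ d → 8 * d + surplus all c * surplus all c) (dicutSize-true (bichromatic c)) ⟨
  8 * dicutSize all (bichromatic c) + surplus all c * surplus all c ≡⟨ line-dicut all c ⟩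
  2 * length (bichromatic c) + imbalance all c * imbalance all c ∎
  where
  open ≡-Reasoning
  all : Fin p → Bool
  all _ = true
  T F : List (Fin p)
  T = class c true
  F = class c false
  p≡ : p ≡ surplus all c
  p≡ = begin
    p                                                          ≡⟨ agreements+disagreements all c ⟨
    agreements all c + disagreements all c                     ≡⟨ cong₂ _+_ (proj₁ (count-class all c)) (proj₂ (count-class all c)) ⟩
    count all T + count (not ∘ all) F + (count (not ∘ all) T + count all F)
      ≡⟨ cong₂ (λ s t → count all T + s + (t + count all F)) (count-none F) (count-none T) ⟩
    count all T + 0 + count all F                              ≡⟨ cong (_+ count all F) (+-identityʳ (count all T)) ⟩
    count all T + count all F                                  ≡⟨ ∣-∣-identityʳ _ ⟨
    ∣ count all T + count all F - 0 ∣                          ≡⟨ cong (∣ count all T + count all F -_∣) (cong₂ _+_ (count-none T) (count-none F)) ⟨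
    surplus all c                                              ∎

sumFin-mono : ∀ N {g h : Fin N → ℕ} → (∀ l → g l ≤ h l) → sumFin N g ≤ sumFin N h
sumFin-mono zero    le = z≤n
sumFin-mono (suc N) le = +-mono-≤ (le zero) (sumFin-mono N (le ∘ suc))

sumFin-+ : ∀ N (g h : Fin N → ℕ) → sumFin N (λ l → g l + h l) ≡ sumFin N g + sumFin N h
sumFin-+ zero    g h = refl
sumFin-+ (suc N) g h = trans (cong (g zero + h zero +_) (sumFin-+ N (g ∘ suc) (h ∘ suc))) (ring (g zero) (h zero) _ _)
  where
  ring : ∀ a b c d → a + b + (c + d) ≡ a + c + (b + d)
  ring = solve-∀

sumFin-* : ∀ N k (g : Fin N → ℕ) → sumFin N (λ l → k * g l) ≡ k * sumFin N g
sumFin-* zero    k g = sym (*-zeroʳ k)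
sumFin-* (suc N) k g = trans (cong (k * g zero +_) (sumFin-* N k (g ∘ suc))) (sym (*-distribˡ-+ k (g zero) _))

sumFin-const : ∀ N k → sumFin N (λ _ → k) ≡ N * k
sumFin-const zero    k = refl
sumFin-const (suc N) k = cong (k +_) (sumFin-const N k)

module SpaceGraph {N p n : ℕ} (space : TriangleFreeSpace N p n) (col : Fin N → Fin p → Bool) where
  open TriangleFreeSpace space

  lineArcs : Fin N → Arcs n
  lineArcs l = relabel (point l) (bichromatic (col l))

  arcs : Arcs n
  arcs = concat (tabulate lineArcs)

  ∈-lineArcs⁻ : ∀ l {a b} → (a , b) ∈ lineArcs l → ∃ λ x → ∃ λ y → a ≡ point l x × b ≡ point l y × col l x ≢ col l y
  ∈-lineArcs⁻ l ab∈ with ∈-map⁻ _ ab∈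
  ... | (x , y) , xy∈ , refl = x , y , refl , refl , ∈-bichromatic⁻ (col l) xy∈

  ∈-arcs⁻ : ∀ {a b} → (a , b) ∈ arcs → ∃ λ l → ∃ λ x → ∃ λ y → a ≡ point l x × b ≡ point l y × col l x ≢ col l y
  ∈-arcs⁻ ab∈ with ∈-concat⁻′ (tabulate lineArcs) ab∈
  ... | _ , ab∈l , l∈ with ∈-tabulate⁻ {f = lineArcs} l∈
  ... | l , refl = l , ∈-lineArcs⁻ l ab∈l

  adjacent⁻ : ∀ {a b} → AdjUG arcs a b → ∃ λ l → ∃ λ x → ∃ λ y → a ≡ point l x × b ≡ point l y × col l x ≢ col l y
  adjacent⁻ (inj₁ ab∈) = ∈-arcs⁻ ab∈
  adjacent⁻ (inj₂ ba∈) with ∈-arcs⁻ ba∈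
  ... | l , x , y , b≡ , a≡ , x≢y = l , y , x , a≡ , b≡ , x≢y ∘ sym

  distinct : ∀ {l x y} → col l x ≢ col l y → x ≢ y
  distinct x≢y refl = x≢y refl

  loopless : Loopless arcs
  loopless u v uv∈ refl with ∈-arcs⁻ uv∈
  ... | l , x , y , u≡ , v≡ , x≢y = distinct x≢y (position-unique (trans (sym u≡) v≡))

  -- The ends of a common arc would be two common points of the lines.
  lineArcs-disjoint : ∀ {k l} → k ≢ l → ∀ {a b} → (a , b) ∈ lineArcs k → (a , b) ∈ lineArcs l → ⊥
  lineArcs-disjoint {k} {l} k≢l ab∈k ab∈l with ∈-lineArcs⁻ k ab∈k | ∈-lineArcs⁻ l ab∈l
  ... | x , y , a≡ , b≡ , x≢y | x′ , y′ , a≡′ , b≡′ , _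
    with position-unique (trans (sym a≡) a≡′) | position-unique (trans (sym b≡) b≡′)
  ... | refl | refl = k≢l (twoPointsDetermine (distinct x≢y) (trans (sym a≡) a≡′) (trans (sym b≡) b≡′))

  unique : Unique arcs
  unique = Unique.concat⁺
    (All.tabulate⁺ λ l → Unique.map⁺ (relabel-injective l) (bichromatic-unique (col l)))
    (AllPairs.tabulate⁺ λ k≢l (∈k , ∈l) → lineArcs-disjoint k≢l ∈k ∈l)
    where
    relabel-injective : ∀ l {xy zw : Fin p × Fin p} →
      (point l (proj₁ xy) , point l (proj₂ xy)) ≡ (point l (proj₁ zw) , point l (proj₂ zw)) → xy ≡ zw
    relabel-injective l eq = let e , e′ = ,-injective eq in cong₂ _,_ (position-unique e) (position-unique e′)

  -- Matching positions at the shared vertices turns a triangle of edges into a triangle of lines.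
  -- By `noTriangle` the three lines are one, on which three points would have pairwise different
  -- colours out of two.
  triangleFree : UGTriangleFree arcs
  triangleFree a b c (ab , bc , ac) with adjacent⁻ ab | adjacent⁻ bc | adjacent⁻ ac
  ... | k , x , y , a≡ , b≡ , x≢y | l , y′ , z , b≡′ , c≡ , y≢z | m , x′ , z′ , a≡′ , c≡′ , x≢z
    with position-unique (trans (sym a≡) a≡′) | position-unique (trans (sym b≡) b≡′) | position-unique (trans (sym c≡) c≡′)
  ... | refl | refl | refl
    with noTriangle (distinct x≢y) (distinct y≢z) (distinct (x≢z ∘ sym)) (trans (sym a≡) a≡′) (trans (sym b≡) b≡′) (trans (sym c≡) c≡′)
  ... | refl , refl = noThreeBools (col k x) (col k y) (col k z) x≢y y≢z x≢z
    where
    noThreeBools : ∀ r s t → r ≢ s → s ≢ t → r ≢ t → ⊥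
    noThreeBools true  true  _     r≢s _ _   = r≢s refl
    noThreeBools true  false true  _ _ r≢t   = r≢t refl
    noThreeBools true  false false _ s≢t _   = s≢t refl
    noThreeBools false false _     r≢s _ _   = r≢s refl
    noThreeBools false true  true  _ s≢t _   = s≢t refl
    noThreeBools false true  false _ _ r≢t   = r≢t refl

  squareImbalance : (Fin n → Bool) → ℕ
  squareImbalance S = sumFin N (λ l → imbalance (S ∘ point l) (col l) * imbalance (S ∘ point l) (col l))

  2*length≡ : ∀ S → 2 * length arcs + squareImbalance S
    ≡ sumFin N (λ l → 2 * length (bichromatic (col l)) + imbalance (S ∘ point l) (col l) * imbalance (S ∘ point l) (col l))
  2*length≡ S = trans (cong (_+ squareImbalance S) (begin
    2 * length arcs                                      ≡⟨ cong (2 *_) (length-concat N lineArcs) ⟩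
    2 * sumFin N (length ∘ lineArcs)                     ≡⟨ sumFin-* N 2 (length ∘ lineArcs) ⟨
    sumFin N (λ l → 2 * length (lineArcs l))             ≡⟨ sumFin-cong N (λ l → cong (2 *_) (length-map _ (bichromatic (col l)))) ⟩
    sumFin N (λ l → 2 * length (bichromatic (col l)))    ∎))
    (sym (sumFin-+ N (λ l → 2 * length (bichromatic (col l))) _))
    where open ≡-Reasoning

  dicut-bound : ∀ S → 8 * dicutSize S arcs ≤ 2 * length arcs + squareImbalance S
  dicut-bound S = begin
    8 * dicutSize S arcs                                   ≡⟨ cong (8 *_) (dicutSize-concat N S lineArcs) ⟩
    8 * sumFin N (dicutSize S ∘ lineArcs)                  ≡⟨ sumFin-* N 8 (dicutSize S ∘ lineArcs) ⟨
    sumFin N (λ l → 8 * dicutSize S (lineArcs l))          ≡⟨ sumFin-cong N (λ l → cong (8 *_) (dicutSize-relabel (point l) S (bichromatic (col l)))) ⟩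
    sumFin N (λ l → 8 * dicutSize (S ∘ point l) (bichromatic (col l)))
      -- Here the square of the surplus is dropped.
      ≤⟨ sumFin-mono N (λ l → ≤-trans (m≤m+n _ _) (≤-reflexive (line-dicut (S ∘ point l) (col l)))) ⟩
    _                                                      ≡⟨ 2*length≡ S ⟨
    2 * length arcs + squareImbalance S                    ∎
    where open ≤-Reasoning

  -- Through this identity the discrepancy bound for the set of all vertices becomes a lower bound
  -- on the number of arcs.
  size-identity : N * (p * p) ≡ 2 * length arcs + squareImbalance (λ _ → true)
  size-identity = begin
    N * (p * p)                     ≡⟨ sumFin-const N (p * p) ⟨
    sumFin N (λ _ → p * p)          ≡⟨ sumFin-cong N (λ l → line-size (col l)) ⟩
    _                               ≡⟨ 2*length≡ (λ _ → true) ⟨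
    2 * length arcs + squareImbalance (λ _ → true) ∎
    where open ≡-Reasoning

  squareImbalance≤ : ∀ S → squareImbalance S ≤ 4 * sumFin N (λ l → triangular (imbalance (S ∘ point l) (col l))) + N
  squareImbalance≤ S = begin
    squareImbalance S                   ≤⟨ sumFin-mono N (λ l → d*d≤4tri+1 (imbalance (S ∘ point l) (col l))) ⟩
    sumFin N (λ l → 4 * t l + 1)        ≡⟨ sumFin-+ N (λ l → 4 * t l) (λ _ → 1) ⟩
    sumFin N (λ l → 4 * t l) + sumFin N (λ _ → 1) ≡⟨ cong₂ _+_ (sumFin-* N 4 t) (trans (sumFin-const N 1) (*-identityʳ N)) ⟩
    4 * sumFin N t + N                  ∎
    where
    open ≤-Reasoning
    t : Fin N → ℕ
    t l = triangular (imbalance (S ∘ point l) (col l))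

-- Disjoint unions

-- Every directed cut has size at most (m + e)/4. Measured this way, the excess `e` is additive
-- under disjoint unions.
record TriangleFreeDigraph (m e : ℕ) : Set where
  field
    order        : ℕ
    arcs         : Arcs order
    size         : length arcs ≡ m
    isDigraph    : IsDigraph arcs
    triangleFree : UGTriangleFree arcs
    cutBound     : ∀ S → 4 * dicutSize S arcs ≤ m + e

open TriangleFreeDigraph

weaken : ∀ {m e e′} → e ≤ e′ → TriangleFreeDigraph m e → TriangleFreeDigraph m e′
weaken e≤e′ D = record
  { order = order D ; arcs = arcs D ; size = size D ; isDigraph = isDigraph D ; triangleFree = triangleFree D
  ; cutBound = λ S → ≤-trans (cutBound D S) (+-monoʳ-≤ _ e≤e′)
  }

empty : TriangleFreeDigraph 0 0
empty = record
  { order = 0 ; arcs = [] ; size = refl ; isDigraph = (λ ()) , [] ; triangleFree = λ () ; cutBound = λ _ → z≤n }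

singleArc : TriangleFreeDigraph 1 3
singleArc = record
  { order = 2 ; arcs = a ; size = refl
  ; isDigraph = (λ { _ _ (here refl) () }) , [] ∷ []
  ; triangleFree = noTriangle
  ; cutBound = λ S → *-monoʳ-≤ 4 (dicutSize≤length S a)
  }
  where
  a : Arcs 2
  a = (zero , suc zero) ∷ []
  noTriangle : UGTriangleFree a
  noTriangle _ _ _ (inj₁ (here refl) , inj₁ (here ()) , _)
  noTriangle _ _ _ (inj₁ (here refl) , inj₂ (here refl) , inj₁ (here ()))
  noTriangle _ _ _ (inj₁ (here refl) , inj₂ (here refl) , inj₂ (here ()))
  noTriangle _ _ _ (inj₂ (here refl) , inj₁ (here refl) , inj₁ (here ()))
  noTriangle _ _ _ (inj₂ (here refl) , inj₁ (here refl) , inj₂ (here ()))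
  noTriangle _ _ _ (inj₂ (here refl) , inj₂ (here ()) , _)

adjacent-relabel⁻ : ∀ {k n} (q : Fin k → Fin n) A {a b} → AdjUG (relabel q A) a b → ∃ λ x → ∃ λ y → a ≡ q x × b ≡ q y × AdjUG A x y
adjacent-relabel⁻ q A (inj₁ ab∈) with ∈-map⁻ _ ab∈
... | (x , y) , xy∈ , refl = x , y , refl , refl , inj₁ xy∈
adjacent-relabel⁻ q A (inj₂ ba∈) with ∈-map⁻ _ ba∈
... | (y , x) , yx∈ , refl = x , y , refl , refl , inj₂ yx∈

adjacent-++⁻ : ∀ {n} (A B : Arcs n) {a b} → AdjUG (A ++ B) a b → AdjUG A a b ⊎ AdjUG B a b
adjacent-++⁻ A B (inj₁ ab∈) with ∈-++⁻ A ab∈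
... | inj₁ ∈A = inj₁ (inj₁ ∈A)
... | inj₂ ∈B = inj₂ (inj₁ ∈B)
adjacent-++⁻ A B (inj₂ ba∈) with ∈-++⁻ A ba∈
... | inj₁ ∈A = inj₁ (inj₂ ∈A)
... | inj₂ ∈B = inj₂ (inj₂ ∈B)

module Relabel {k n : ℕ} (q : Fin k → Fin n) (q-injective : ∀ {x y} → q x ≡ q y → x ≡ y) (A : Arcs k) where

  relabel-isDigraph : IsDigraph A → IsDigraph (relabel q A)
  relabel-isDigraph (loopless , unique) = loopless′ , Unique.map⁺ injective unique
    where
    loopless′ : Loopless (relabel q A)
    loopless′ a b ab∈ a≡b with ∈-map⁻ _ ab∈
    ... | (x , y) , xy∈ , refl = loopless x y xy∈ (q-injective a≡b)
    injective : ∀ {xy zw : Fin k × Fin k} → (q (proj₁ xy) , q (proj₂ xy)) ≡ (q (proj₁ zw) , q (proj₂ zw)) → xy ≡ zw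
    injective eq = let e , e′ = ,-injective eq in cong₂ _,_ (q-injective e) (q-injective e′)

  relabel-triangleFree : UGTriangleFree A → UGTriangleFree (relabel q A)
  relabel-triangleFree free a b c (ab , bc , ac)
    with adjacent-relabel⁻ q A ab | adjacent-relabel⁻ q A bc | adjacent-relabel⁻ q A ac
  ... | x , y , refl , refl , xy | y′ , z , b≡ , refl , yz | x′ , z′ , a≡ , c≡ , xz
    with q-injective b≡ | q-injective a≡ | q-injective c≡
  ... | refl | refl | refl = free x y z (xy , yz , xz)

module DisjointUnion {k n : ℕ} (A : Arcs k) (B : Arcs n) where

  left : Arcs (k + n)
  left = relabel (_↑ˡ n) A

  right : Arcs (k + n)
  right = relabel (k ↑ʳ_) B

  ↑ˡ≢↑ʳ : ∀ {x : Fin k} {y : Fin n} → x ↑ˡ n ≢ k ↑ʳ y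
  ↑ˡ≢↑ʳ {x} {y} eq with trans (sym (splitAt-↑ˡ k x n)) (trans (cong (splitAt k) eq) (splitAt-↑ʳ k n y))
  ... | ()

  noCommonVertex : ∀ {a b c} → AdjUG left a b → AdjUG right b c → ⊥
  noCommonVertex ab bc with adjacent-relabel⁻ (_↑ˡ n) A ab | adjacent-relabel⁻ (k ↑ʳ_) B bc
  ... | _ , _ , _ , refl , _ | _ , _ , b≡ , _ , _ = ↑ˡ≢↑ʳ b≡

  adjacent-sym : ∀ {n} {A : Arcs n} {a b} → AdjUG A a b → AdjUG A b a
  adjacent-sym (inj₁ ab∈) = inj₂ ab∈
  adjacent-sym (inj₂ ba∈) = inj₁ ba∈

  union-isDigraph : IsDigraph A → IsDigraph B → IsDigraph (left ++ right)
  union-isDigraph dA dB = loopless , Unique.++⁺ (proj₂ dA′) (proj₂ dB′) λ (∈l , ∈r) → noCommonVertex (inj₂ ∈l) (inj₁ ∈r)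
    where
    dA′ : IsDigraph left
    dA′ = Relabel.relabel-isDigraph (_↑ˡ n) (↑ˡ-injective n _ _) A dA
    dB′ : IsDigraph right
    dB′ = Relabel.relabel-isDigraph (k ↑ʳ_) (↑ʳ-injective k _ _) B dB
    loopless : Loopless (left ++ right)
    loopless u v uv∈ with ∈-++⁻ left uv∈
    ... | inj₁ ∈l = proj₁ dA′ u v ∈l
    ... | inj₂ ∈r = proj₁ dB′ u v ∈r

  union-triangleFree : UGTriangleFree A → UGTriangleFree B → UGTriangleFree (left ++ right)
  union-triangleFree fA fB a b c (ab , bc , ac)
    with adjacent-++⁻ left right ab | adjacent-++⁻ left right bc | adjacent-++⁻ left right ac
  ... | inj₁ ab | inj₁ bc | inj₁ ac = Relabel.relabel-triangleFree (_↑ˡ n) (↑ˡ-injective n _ _) A fA a b c (ab , bc , ac)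
  ... | inj₂ ab | inj₂ bc | inj₂ ac = Relabel.relabel-triangleFree (k ↑ʳ_) (↑ʳ-injective k _ _) B fB a b c (ab , bc , ac)
  ... | inj₁ ab | inj₂ bc | _       = noCommonVertex ab bc
  ... | inj₂ ab | inj₁ bc | _       = noCommonVertex (adjacent-sym bc) (adjacent-sym ab)
  ... | inj₁ ab | inj₁ bc | inj₂ ac = noCommonVertex (adjacent-sym ab) ac
  ... | inj₂ ab | inj₂ bc | inj₁ ac = noCommonVertex (adjacent-sym ac) ab

_⊎ᴰ_ : ∀ {m m′ e e′} → TriangleFreeDigraph m e → TriangleFreeDigraph m′ e′ → TriangleFreeDigraph (m + m′) (e + e′)
_⊎ᴰ_ {m} {m′} {e} {e′} D D′ = record
  { order        = order D + order D′
  ; arcs         = left ++ right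
  ; size         = trans (length-++ left) (cong₂ _+_ (trans (length-map _ (arcs D)) (size D)) (trans (length-map _ (arcs D′)) (size D′)))
  ; isDigraph    = union-isDigraph (isDigraph D) (isDigraph D′)
  ; triangleFree = union-triangleFree (triangleFree D) (triangleFree D′)
  ; cutBound     = bound
  }
  where
  open DisjointUnion (arcs D) (arcs D′)
  open ≤-Reasoning
  ring : ∀ a b c d → a + b + (c + d) ≡ a + c + (b + d)
  ring = solve-∀
  bound : ∀ S → 4 * dicutSize S (left ++ right) ≤ m + m′ + (e + e′)
  bound S = begin
    4 * dicutSize S (left ++ right)                 ≡⟨ cong (4 *_) (dicutSize-++ S left right) ⟩
    4 * (dicutSize S left + dicutSize S right)      ≡⟨ *-distribˡ-+ 4 (dicutSize S left) _ ⟩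
    4 * dicutSize S left + 4 * dicutSize S right    ≡⟨ cong₂ (λ s t → 4 * s + 4 * t) (dicutSize-relabel (_↑ˡ order D′) S (arcs D)) (dicutSize-relabel (order D ↑ʳ_) S (arcs D′)) ⟩
    _                                               ≤⟨ +-mono-≤ (cutBound D _) (cutBound D′ _) ⟩
    m + e + (m′ + e′)                               ≡⟨ ring m e m′ e′ ⟩
    m + m′ + (e + e′)                               ∎

copies : ∀ {m e} k → TriangleFreeDigraph m e → TriangleFreeDigraph (k * m) (k * e)
copies zero    D = empty
copies (suc k) D = D ⊎ᴰ copies k D

-- Realising every number of arcs

-- With N = n = p³ the discrepancy bound makes the squared imbalance at most 34p⁴, against a total N
-- p² = p⁵; hence the excess 17p⁴ and a number of arcs close to p⁵/2.
cubicSpaceDigraph : ∀ p → Prime p → 256 ≤ p → ∃ λ m →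
  TriangleFreeDigraph m (17 * p ^ 4) × p ^ 5 ≤ 4 * m × m ≤ p ^ 5
cubicSpaceDigraph p pr 256≤p = m , record
  { order        = N
  ; arcs         = G.arcs
  ; size         = refl
  ; isDigraph    = G.loopless , G.unique
  ; triangleFree = G.triangleFree
  ; cutBound     = λ S → *-cancelˡ-≤ 2 (begin
      2 * (4 * dicutSize S G.arcs)      ≡⟨ *-assoc 2 4 (dicutSize S G.arcs) ⟨
      8 * dicutSize S G.arcs            ≤⟨ G.dicut-bound S ⟩
      2 * m + G.squareImbalance S       ≤⟨ +-monoʳ-≤ (2 * m) (imbalanceBound S) ⟩
      2 * m + 34 * p ^ 4                ≡⟨ ring₁ m (p ^ 4) ⟩
      2 * (m + 17 * p ^ 4)              ∎)
  } , lower , upper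
  where
  open ≤-Reasoning
  N : ℕ
  N = p * (p * p)
  instance
    p≢0 : NonZero p
    p≢0 = prime⇒nonZero pr
  space : TriangleFreeSpace N p N
  space = PrimeModulus.primeSpace p pr
  colours : ∃ λ (col : Fin N → Fin p → Bool) → ∀ S → sumFin N (λ l → triangular (imbalance (S ∘ TriangleFreeSpace.point space l) (col l))) ≤ (N + N) * (4 * p)
  colours = lowDiscrepancy N p (>-nonZero⁻¹ p) (TriangleFreeSpace.point space)
  module G = SpaceGraph space (proj₁ colours)
  m : ℕ
  m = length G.arcs
  ring₁ : ∀ m q → 2 * m + 34 * q ≡ 2 * (m + 17 * q)
  ring₁ = solve-∀
  ring₂ : ∀ p → 4 * ((p * (p * p) + p * (p * p)) * (4 * p)) + p * (p * p) * 2 * p ≡ 34 * (p * (p * (p * (p * 1))))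
  ring₂ = solve-∀
  ring₃ : ∀ p → p * (p * (p * (p * (p * 1)))) ≡ p * (p * p) * (p * p)
  ring₃ = solve-∀
  imbalanceBound : ∀ S → G.squareImbalance S ≤ 34 * p ^ 4
  imbalanceBound S = begin
    G.squareImbalance S                   ≤⟨ G.squareImbalance≤ S ⟩
    4 * sumFin N (λ l → triangular (imbalance (S ∘ TriangleFreeSpace.point space l) (proj₁ colours l))) + N
      -- The leftover `N` is rounded up to 2p⁴, so that 32p⁴ + 2p⁴ can be halved evenly.
      ≤⟨ +-mono-≤ (*-monoʳ-≤ 4 (proj₂ colours S)) (≤-trans (m≤m*n N 2) (m≤m*n (N * 2) p)) ⟩
    4 * ((N + N) * (4 * p)) + N * 2 * p   ≡⟨ ring₂ p ⟩
    34 * p ^ 4                            ∎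
  upper : m ≤ p ^ 5
  upper = begin
    m             ≤⟨ m≤n*m m 2 ⟩
    2 * m         ≤⟨ m≤m+n (2 * m) _ ⟩
    2 * m + G.squareImbalance (λ _ → true) ≡⟨ G.size-identity ⟨
    N * (p * p)   ≡⟨ ring₃ p ⟨
    p ^ 5         ∎
  ring₄ : ∀ x → x + x ≡ 2 * x
  ring₄ = solve-∀
  ring₅ : ∀ m q → 2 * (2 * m + 34 * q) ≡ 4 * m + 68 * q
  ring₅ = solve-∀
  lower : p ^ 5 ≤ 4 * m
  lower = +-cancelʳ-≤ (p ^ 5) _ _ (begin
    p ^ 5 + p ^ 5                             ≡⟨ ring₄ (p ^ 5) ⟩
    2 * p ^ 5                                 ≡⟨ cong (2 *_) (trans (ring₃ p) G.size-identity) ⟩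
    2 * (2 * m + G.squareImbalance (λ _ → true)) ≤⟨ *-monoʳ-≤ 2 (+-monoʳ-≤ (2 * m) (imbalanceBound _)) ⟩
    2 * (2 * m + 34 * p ^ 4)                  ≡⟨ ring₅ m (p ^ 4) ⟩
    -- Only 68 ≤ p matters at this point; 256 is 4^4, below which no prime is taken.
    4 * m + 68 * p ^ 4                        ≤⟨ +-monoʳ-≤ (4 * m) (*-monoˡ-≤ (p ^ 4) (≤-trans (m≤m+n 68 188) 256≤p)) ⟩
    4 * m + p ^ 5                             ∎)

-- Opaque, so that products such as 4 ^ 11 * M are never unfolded into iterated sums.
opaque
  pow4 : ℕ → ℕ
  pow4 n = 4 ^ n

  pow4≡ : ∀ n → pow4 n ≡ 4 ^ n
  pow4≡ n = refl

  pow4-+ : ∀ a b → pow4 (a + b) ≡ pow4 a * pow4 b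
  pow4-+ = ^-distribˡ-+-* 4

  pow4-^ : ∀ a b → pow4 a ^ b ≡ pow4 (a * b)
  pow4-^ = ^-*-assoc 4

  pow4-mono : ∀ {a b} → a ≤ b → pow4 a ≤ pow4 b
  pow4-mono = ^-monoʳ-≤ 4

  pow4>0 : ∀ a → 0 < pow4 a
  pow4>0 = m^n>0 4

pow4≢0 : ∀ a → NonZero (pow4 a)
pow4≢0 a = >-nonZero (pow4>0 a)

-- The prime lies in (4^(k-1), 4^k]. Its distance from 4^k costs a factor 4^5 in the fifth power,
-- and `p ^ 5 ≤ 4 * M` costs one more 4.
levelDigraph : ∀ k → 5 ≤ k → ∃ λ M →
  TriangleFreeDigraph M (17 * pow4 (4 * k)) × pow4 (5 * k) ≤ pow4 6 * M × M ≤ pow4 (5 * k)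
levelDigraph (suc i) (s≤s 4≤i) =
  let p , pr , 4^i<p , p≤4^k = primeExists i 4≤i
      M , D , p^5≤ , ≤p^5    = cubicSpaceDigraph p pr (≤-trans (^-monoʳ-≤ 4 4≤i) (<⇒≤ 4^i<p))
  in M , weaken (*-monoʳ-≤ 17 (power p 4 p≤4^k)) D , lower p M 4^i<p p^5≤ , ≤-trans ≤p^5 (power p 5 p≤4^k)
  where
  open ≤-Reasoning
  power : ∀ p e → p ≤ 4 ^ suc i → p ^ e ≤ pow4 (e * suc i)
  power p e p≤ = ≤-trans (^-monoˡ-≤ e (≤-trans p≤ (≤-reflexive (sym (pow4≡ (suc i))))))
    (≤-reflexive (trans (pow4-^ (suc i) e) (cong pow4 (*-comm (suc i) e))))
  lower : ∀ p M → 4 ^ i < p → p ^ 5 ≤ 4 * M → pow4 (5 * suc i) ≤ pow4 6 * M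
  lower p M 4^i<p p^5≤ = begin
    pow4 (5 * suc i)         ≡⟨ cong pow4 (*-suc 5 i) ⟩
    pow4 (5 + 5 * i)         ≡⟨ pow4-+ 5 (5 * i) ⟩
    pow4 5 * pow4 (5 * i)    ≡⟨ cong (pow4 5 *_) (trans (cong pow4 (*-comm 5 i)) (sym (pow4-^ i 5))) ⟩
    pow4 5 * pow4 i ^ 5      ≤⟨ *-monoʳ-≤ (pow4 5) (^-monoˡ-≤ 5 (≤-trans (≤-reflexive (pow4≡ i)) (<⇒≤ 4^i<p))) ⟩
    pow4 5 * p ^ 5           ≤⟨ *-monoʳ-≤ (pow4 5) p^5≤ ⟩
    pow4 5 * (4 * M)         ≡⟨ *-assoc (pow4 5) 4 M ⟨
    pow4 5 * 4 * M           ≡⟨ cong (λ t → pow4 5 * t * M) (pow4≡ 1) ⟨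
    pow4 5 * pow4 1 * M      ≡⟨ cong (_* M) (pow4-+ 5 1) ⟨
    pow4 6 * M               ∎

-- Division with remainder: `m / M` copies of `D`, then a filling of the remainder from the level
-- below. There are at most 4^11 copies, since m < 4^(5k+5) and M ≥ 4^(5k-6).
fillStep : ∀ k m M → TriangleFreeDigraph M (17 * pow4 (4 * k)) → pow4 (5 * k) ≤ pow4 6 * M → M ≤ pow4 (5 * k) →
  (∀ r → r < pow4 (5 * k) → TriangleFreeDigraph r (pow4 11 * pow4 (4 * k))) →
  m < pow4 (5 * suc k) → TriangleFreeDigraph m (pow4 11 * pow4 (4 * suc k))
fillStep k m M D lower upper rest m< = subst (λ k → TriangleFreeDigraph k _) m≡
  (weaken excess (copies q D ⊎ᴰ rest (m % M) (<-≤-trans (m%n<n m M) upper)))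
  where
  open ≤-Reasoning
  E : ℕ
  E = pow4 (4 * k)
  instance
    4^5k≢0 : NonZero (pow4 (5 * k))
    4^5k≢0 = pow4≢0 (5 * k)
    M≢0 : NonZero M
    M≢0 = m*n≢0⇒n≢0 (pow4 6) {{>-nonZero (≤-trans (pow4>0 (5 * k)) lower)}}
  q : ℕ
  q = m / M
  m≡ : q * M + m % M ≡ m
  m≡ = trans (+-comm (q * M) _) (sym (m≡m%n+[m/n]*n m M))
  ring₁ : ∀ a b c → a * (b * c) ≡ b * (a * c)
  ring₁ = solve-∀
  ring₂ : ∀ a b → a * (17 * b) + a * b ≡ a * b * 18
  ring₂ = solve-∀
  q≤ : q ≤ pow4 11
  q≤ = *-cancelʳ-≤ q (pow4 11) (pow4 (5 * k)) (begin
    q * pow4 (5 * k)              ≤⟨ *-monoʳ-≤ q lower ⟩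
    q * (pow4 6 * M)              ≡⟨ ring₁ q (pow4 6) M ⟩
    pow4 6 * (q * M)              ≤⟨ *-monoʳ-≤ (pow4 6) (≤-trans (m/n*n≤m m M) (<⇒≤ m<)) ⟩
    pow4 6 * pow4 (5 * suc k)     ≡⟨ cong (λ e → pow4 6 * pow4 e) (*-suc 5 k) ⟩
    pow4 6 * pow4 (5 + 5 * k)     ≡⟨ pow4-+ 6 (5 + 5 * k) ⟨
    pow4 (11 + 5 * k)             ≡⟨ pow4-+ 11 (5 * k) ⟩
    pow4 11 * pow4 (5 * k)        ∎)
  excess : q * (17 * E) + pow4 11 * E ≤ pow4 11 * pow4 (4 * suc k)
  excess = begin
    q * (17 * E) + pow4 11 * E       ≤⟨ +-monoˡ-≤ (pow4 11 * E) (*-monoˡ-≤ (17 * E) q≤) ⟩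
    pow4 11 * (17 * E) + pow4 11 * E ≡⟨ ring₂ (pow4 11) E ⟩
    -- The bound reproduces itself: 17 + 1 = 18 is less than 4^4, the growth of the excess from one
    -- level to the next.
    pow4 11 * E * 18                 ≤⟨ *-monoʳ-≤ (pow4 11 * E) (≤-trans (m≤m+n 18 238) (≤-reflexive (sym (pow4≡ 4)))) ⟩
    pow4 11 * E * pow4 4             ≡⟨ *-assoc (pow4 11) E (pow4 4) ⟩
    pow4 11 * (E * pow4 4)           ≡⟨ cong (pow4 11 *_) (pow4-+ (4 * k) 4) ⟨
    pow4 11 * pow4 (4 * k + 4)       ≡⟨ cong (λ e → pow4 11 * pow4 e) (trans (+-comm (4 * k) 4) (sym (*-suc 4 k))) ⟩
    pow4 11 * pow4 (4 * suc k)       ∎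

fill : ∀ j m → m < pow4 (5 * (5 + j)) → TriangleFreeDigraph m (pow4 11 * pow4 (4 * (5 + j)))
-- The bottom level uses `m` separate arcs with excess 3 each; as m < 4^25, a constant bound absorbs
-- them.
fill zero    m m< = subst (λ k → TriangleFreeDigraph k (pow4 11 * pow4 20)) (*-identityʳ m) (weaken (begin
  m * 3                ≤⟨ *-mono-≤ (<⇒≤ m<) (n≤1+n 3) ⟩
  pow4 25 * 4          ≡⟨ cong (pow4 25 *_) (pow4≡ 1) ⟨
  pow4 25 * pow4 1     ≡⟨ pow4-+ 25 1 ⟨
  pow4 26              ≤⟨ pow4-mono (m≤m+n 26 5) ⟩
  pow4 31              ≡⟨ pow4-+ 11 20 ⟩
  pow4 11 * pow4 20    ∎) (copies m singleArc))
  where open ≤-Reasoning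
fill (suc j) m m< =
  let M , D , lower , upper = levelDigraph (5 + j) (m≤m+n 5 j)
  in fillStep (5 + j) m M D lower upper (fill j) m<

-- Descending to the lowest level that still admits `m` ensures m ≥ 4^(5k) above the bottom, so the
-- excess 4^15 4^(4k) is at most 4^15 m^(4/5). At the bottom the excess is 4^31, which fixes the
-- constant.
fill⁵ : ∀ j m → 0 < m → m < pow4 (5 * (5 + j)) → ∃ λ e → TriangleFreeDigraph m e × e ^ 5 ≤ pow4 31 ^ 5 * m ^ 4
fill⁵ zero m 0<m m< = pow4 11 * pow4 20 , fill zero m m< , (begin
  (pow4 11 * pow4 20) ^ 5    ≡⟨ cong (_^ 5) (pow4-+ 11 20) ⟨
  pow4 31 ^ 5                ≤⟨ m≤m*n (pow4 31 ^ 5) (m ^ 4) {{m^n≢0 m 4 {{>-nonZero 0<m}}}} ⟩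
  pow4 31 ^ 5 * m ^ 4        ∎)
  where open ≤-Reasoning
fill⁵ (suc j) m 0<m m< with m <? pow4 (5 * (5 + j))
... | yes m<′ = fill⁵ j m 0<m m<′
... | no  m≮  = pow4 11 * pow4 (4 * suc k) , fill (suc j) m m< , (begin
  (pow4 11 * pow4 (4 * suc k)) ^ 5      ≡⟨ cong (λ e → (pow4 11 * pow4 e) ^ 5) (*-suc 4 k) ⟩
  (pow4 11 * pow4 (4 + 4 * k)) ^ 5      ≡⟨ cong (_^ 5) (pow4-+ 11 (4 + 4 * k)) ⟨
  pow4 (15 + 4 * k) ^ 5                 ≡⟨ cong (_^ 5) (pow4-+ 15 (4 * k)) ⟩
  (pow4 15 * pow4 (4 * k)) ^ 5          ≡⟨ ^-distribʳ-* (pow4 15) (pow4 (4 * k)) 5 ⟩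
  pow4 15 ^ 5 * pow4 (4 * k) ^ 5        ≤⟨ *-mono-≤ (^-monoˡ-≤ 5 (pow4-mono (m≤m+n 15 16))) (≤-reflexive swap) ⟩
  pow4 31 ^ 5 * pow4 (5 * k) ^ 4        ≤⟨ *-monoʳ-≤ (pow4 31 ^ 5) (^-monoˡ-≤ 4 (≮⇒≥ m≮)) ⟩
  pow4 31 ^ 5 * m ^ 4                   ∎)
  where
  open ≤-Reasoning
  k : ℕ
  k = 5 + j
  ring : ∀ k → 4 * k * 5 ≡ 5 * k * 4
  ring = solve-∀
  swap : pow4 (4 * k) ^ 5 ≡ pow4 (5 * k) ^ 4
  swap = trans (pow4-^ (4 * k) 5) (trans (cong pow4 (ring k)) (sym (pow4-^ (5 * k) 4)))

m<pow4 : ∀ m → m < pow4 m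
m<pow4 zero    = pow4>0 0
m<pow4 (suc m) = begin-strict
  suc m             ≤⟨ m<pow4 m ⟩
  pow4 m            <⟨ m<m*n (pow4 m) 4 {{pow4≢0 m}} (s≤s (s≤s z≤n)) ⟩
  pow4 m * 4        ≡⟨ *-comm (pow4 m) 4 ⟩
  4 * pow4 m        ≡⟨ cong (_* pow4 m) (pow4≡ 1) ⟨
  pow4 1 * pow4 m   ≡⟨ pow4-+ 1 m ⟨
  pow4 (suc m)      ∎
  where open ≤-Reasoning

-- The inequality `dicut ≤ m/4 + c m^(4/5)` is multiplied by 4 and raised to the fifth power to stay
-- within the naturals; truncated subtraction makes it hold trivially when 4 times the dicut is at
-- most `m`.
theorem8 : Σ ℕ λ c → 0 < c × ((m : ℕ) → 0 < m →
    Σ ℕ λ n → Σ (Arcs n) λ A →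
    length A ≡ m × IsDigraph A × UGTriangleFree A ×
    ((S : Fin n → Bool) → (4 * dicutSize S A ∸ m) ^ 5 ≤ (4 * c) ^ 5 * m ^ 4))
-- With c = 4^30 the factor `4 * c` is the 4^31 of `fill⁵`; its descent can start from j = m because
-- m < 4^m.
theorem8 = pow4 30 , pow4>0 30 , λ m 0<m →
  let e , D , e^5≤ = fill⁵ m m 0<m (<-≤-trans (m<pow4 m) (pow4-mono (≤-trans (m≤n+m m 5) (m≤n*m (5 + m) 5))))
  in order D , arcs D , size D , isDigraph D , triangleFree D , λ S → begin
    (4 * dicutSize S (arcs D) ∸ m) ^ 5  ≤⟨ ^-monoˡ-≤ 5 (m≤n+o⇒m∸n≤o (4 * dicutSize S (arcs D)) m (cutBound D S)) ⟩
    e ^ 5                               ≤⟨ e^5≤ ⟩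
    pow4 31 ^ 5 * m ^ 4                 ≡⟨ cong (λ t → t ^ 5 * m ^ 4) (pow4-+ 1 30) ⟩
    (pow4 1 * pow4 30) ^ 5 * m ^ 4      ≡⟨ cong (λ t → (t * pow4 30) ^ 5 * m ^ 4) (pow4≡ 1) ⟩
    (4 * pow4 30) ^ 5 * m ^ 4           ∎
  where open ≤-Reasoning
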